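{- Let $n\ge 2$ and for a partition $\nu\vdash m$ let $C(\nu)$ denote the number of pair partitions of $\{1,\dots,2m\}$ of coset-type $\nu$. For every partition $\lambda\vdash n$, $$C(\lambda)=\sum_{\substack{\mu\subset\lambda\\ \mu\vdash n-1}}\mu^{\lambda}\,C(\mu),$$ where the sum is over partitions $\mu$ of $n-1$ whose Young diagram is contained in that of $\lambda$, and $\mu^\lambda$ is defined as follows: let $i$ be the unique row index with $\lambda_i=\mu_i+1$ (where $\mu_i:=0$ if $i>\ell(\mu)$), set $\mu_-=\mu_i$, and let $m_{\mu_- }$ be the number of parts of $\mu$ equal to $\mu_-$; then $\mu^\lambda=2\mu_-m_{\mu_- }$ if $\mu_->0$ and $\mu^\lambda=1$ if $\mu_-=0$.
   Context: A pair partition of $\{1,\dots,2m\}$ is a set partition of $\{1,\dots,2m\}$ into $m$ blocks of size $2$. For a pair partition $\sigma$, let $\Gamma(\sigma)$ be the multigraph on vertex set $\{1,\dots,2m\}$ whose edges are the $m$ pairs $\{2k-1,2k\}$ ($k=1,\dots,m$) together with the $m$ blocks of $\sigma$ (an edge may appear twice). Every vertex has degree $2$, so each connected component has an even number $2k$ of vertices; the coset-type of $\sigma$ is the partition of $m$ whose parts are the numbers $k$ (half the number of vertices) of the connected components of $\Gamma(\sigma)$, arranged in decreasing order. For a partition $\mu$, $\ell(\mu)$ is its number of nonzero parts. -}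

module Defs where

open import Data.Bool using (Bool; true; false; _∧_; _∨_; not; if_then_else_; T)
open import Data.Nat using (ℕ; zero; suc; _+_; _*_; _∸_; _≤_; _≥_; _<_; _≤?_; _≥?_; _≟_; _≡ᵇ_; _<ᵇ_; _≤ᵇ_; _/_)
open import Data.List using (List; []; _∷_; length; map; filter; filterᵇ; upTo; concatMap; foldr)
open import Data.Nat.ListAction using (sum)
open import Data.Bool.ListAction using (and; or)
open import Data.List.Relation.Unary.All using (All; all?)
open import Data.List.Relation.Unary.Linked using (Linked; linked?)
open import Data.Product using (_×_; _,_)
open import Relation.Nullary using (Dec; yes; no)
open import Relation.Nullary.Decidable using (_×-dec_)
open import Relation.Binary.PropositionalEquality using (_≡_)

record IsPartitionOf (m : ℕ) (ν : List ℕ) : Set where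
  field
    positive   : All (λ x → 1 ≤ x) ν
    decreasing : Linked _≥_ ν
    sums       : sum ν ≡ m

isPartitionOf? : (m : ℕ) (ν : List ℕ) → Dec (IsPartitionOf m ν)
isPartitionOf? m ν with all? (λ x → 1 ≤? x) ν | linked? _≥?_ ν | sum ν ≟ m
... | yes a | yes b | yes c = yes (record { positive = a ; decreasing = b ; sums = c })
... | no ¬a | _ | _ = no (λ p → ¬a (IsPartitionOf.positive p))
... | yes _ | no ¬b | _ = no (λ p → ¬b (IsPartitionOf.decreasing p))
... | yes _ | yes _ | no ¬c = no (λ p → ¬c (IsPartitionOf.sums p))

part : List ℕ → ℕ → ℕ
part []       _       = 0
part (x ∷ xs) zero    = x
part (x ∷ xs) (suc i) = part xs i

data _⊆Y_ : List ℕ → List ℕ → Set where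
  []⊆ : ∀ {ys} → [] ⊆Y ys
  ∷⊆  : ∀ {x xs} → x ≤ 0 → xs ⊆Y [] → (x ∷ xs) ⊆Y []
  ∷⊆∷ : ∀ {x y xs ys} → x ≤ y → xs ⊆Y ys → (x ∷ xs) ⊆Y (y ∷ ys)

_⊆Y?_ : (xs ys : List ℕ) → Dec (xs ⊆Y ys)
[] ⊆Y? ys = yes []⊆
(x ∷ xs) ⊆Y? [] with x ≤? 0 | xs ⊆Y? []
... | yes p | yes q = yes (∷⊆ p q)
... | no ¬p | _ = no λ { (∷⊆ p _) → ¬p p }
... | yes _ | no ¬q = no λ { (∷⊆ _ q) → ¬q q }
(x ∷ xs) ⊆Y? (y ∷ ys) with x ≤? y | xs ⊆Y? ys
... | yes p | yes q = yes (∷⊆∷ p q)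
... | no ¬p | _ = no λ { (∷⊆∷ p _) → ¬p p }
... | yes _ | no ¬q = no λ { (∷⊆∷ _ q) → ¬q q }

-- All lists of length ≤ L with entries in {1,…,k}.  Every partition of m
-- occurs (exactly once) in  listsUpTo m m.
listsUpTo : ℕ → ℕ → List (List ℕ)
listsUpTo zero    k = [] ∷ []
listsUpTo (suc L) k = [] ∷ concatMap (λ x → map (suc x ∷_) (listsUpTo L k)) (upTo k)

partitionsOf : ℕ → List (List ℕ)
partitionsOf m = filter (isPartitionOf? m) (listsUpTo m m)

-- Pair partitions of {1,…,2m}.  Vertices are 0,…,2m-1 (vertex v here is
-- the element v+1 of the paper).  A pair partition is encoded by its
-- partner function p, given as the list (p 0, …, p (2m-1)); its blocks are
-- {v , p v}.  Such a list encodes a pair partition iff p is a fixed-point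
-- free involution of {0,…,2m-1}.

lists : ℕ → ℕ → List (List ℕ)
lists zero    K = [] ∷ []
lists (suc N) K = concatMap (λ x → map (x ∷_) (lists N K)) (upTo K)

allB : ℕ → (ℕ → Bool) → Bool
allB N f = and (map f (upTo N))

anyB : ℕ → (ℕ → Bool) → Bool
anyB N f = or (map f (upTo N))

countB : ℕ → (ℕ → Bool) → ℕ
countB N f = length (filterᵇ f (upTo N))

isPairPartitionᵇ : ℕ → List ℕ → Bool
isPairPartitionᵇ N p =
  (length p ≡ᵇ N) ∧ allB N (λ v → (part p v <ᵇ N) ∧ (part p (part p v) ≡ᵇ v) ∧ not (part p v ≡ᵇ v))

-- Edges of Γ(σ): the fixed pairs {2k,2k+1} (i.e. {2k-1,2k} in 1-indexing)
-- and the blocks {v, p v} of σ.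
adjᵇ : List ℕ → ℕ → ℕ → Bool
adjᵇ p u w = ((u / 2 ≡ᵇ w / 2) ∧ not (u ≡ᵇ w)) ∨ (part p u ≡ᵇ w) ∨ (part p w ≡ᵇ u)

reach : List ℕ → ℕ → ℕ → ℕ → ℕ → Bool
reach p N zero    v w = v ≡ᵇ w
reach p N (suc t) v w = reach p N t v w ∨ anyB N (λ u → reach p N t v u ∧ adjᵇ p u w)

-- connected in Γ (paths of length ≤ N suffice on N vertices)
connᵇ : List ℕ → ℕ → ℕ → ℕ → Bool
connᵇ p N v w = reach p N N v w

compSize : List ℕ → ℕ → ℕ → ℕ
compSize p N v = countB N (connᵇ p N v)

isRepᵇ : List ℕ → ℕ → ℕ → Bool
isRepᵇ p N v = not (anyB v (connᵇ p N v))

insertDesc : ℕ → List ℕ → List ℕ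
insertDesc x [] = x ∷ []
insertDesc x (y ∷ ys) = if y ≤ᵇ x then x ∷ y ∷ ys else y ∷ insertDesc x ys

sortDesc : List ℕ → List ℕ
sortDesc = foldr insertDesc []

cosetType : ℕ → List ℕ → List ℕ
cosetType m p =
  sortDesc (map (λ v → compSize p (2 * m) v / 2) (filterᵇ (isRepᵇ p (2 * m)) (upTo (2 * m))))

listEqᵇ : List ℕ → List ℕ → Bool
listEqᵇ [] [] = true
listEqᵇ [] (_ ∷ _) = false
listEqᵇ (_ ∷ _) [] = false
listEqᵇ (x ∷ xs) (y ∷ ys) = (x ≡ᵇ y) ∧ listEqᵇ xs ys

C : ℕ → List ℕ → ℕ
C m ν = length (filterᵇ (λ p → isPairPartitionᵇ (2 * m) p ∧ listEqᵇ (cosetType m p) ν)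
                        (lists (2 * m) (2 * m)))

findRow : List ℕ → List ℕ → ℕ → ℕ → ℕ
findRow μ la zero    i = i
findRow μ la (suc L) i = if part la i ≡ᵇ suc (part μ i) then i else findRow μ la L (suc i)

multiplicity : List ℕ → ℕ → ℕ
multiplicity μ a = length (filterᵇ (λ x → x ≡ᵇ a) μ)

coef : List ℕ → List ℕ → ℕ
coef μ la with part μ (findRow μ la (length la) 0)
... | zero    = 1
... | suc k   = 2 * suc k * multiplicity μ (suc k)

{-# OPTIONS --safe #-}
-- Delete the vertices 2n-1 and 2n from a pair partition of {1,…,2n}, joining
-- their partners to each other unless {2n-1, 2n} is itself a block.  This is a
-- bijection onto pairs (σ , c), where σ is a pair partition of {1,…,2n-2} and
-- c is one of its vertices or a symbol for "{2n-1, 2n} is a block".  Undoing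
-- the deletion at a vertex c raises by one the part k of the coset-type given
-- by the component of c, and 2 k m_k vertices lie in components of half-size
-- k; adding the block {2n-1, 2n} adds a part 1.  Since k is determined by the
-- old and the new coset-type, each σ of coset-type μ has μ^λ extensions of
-- coset-type λ if μ ⊂ λ, and none otherwise.
module Submission where

open import Defs
open import Data.Bool using (Bool; true; false; _∧_; _∨_; not; T)
open import Data.Bool.ListAction using (and; or)
open import Data.Bool.Properties using (T-∧; T-∨; T?; ∨-assoc; ∨-identityʳ)
open import Data.Empty using (⊥-elim)
open import Data.List using (List; []; _∷_; _++_; length; map; filter; filterᵇ; upTo; applyUpTo; concatMap; cartesianProduct; cartesianProductWith)
open import Data.List.Membership.Propositional using (_∈_)
open import Data.List.Membership.Propositional.Properties using (∈-upTo⁺; ∈-upTo⁻; ∈-filter⁺; ∈-filter⁻; ∈-map⁺; ∈-map⁻; ∈-++⁺ˡ; ∈-++⁺ʳ; ∈-++⁻; ∈-cartesianProductWith⁺; ∈-cartesianProductWith⁻; ∈-cartesianProduct⁺; ∈-cartesianProduct⁻)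
open import Data.List.Membership.Propositional.Properties.WithK using (unique∧set⇒bag)
open import Data.List.Properties using (map-++; map-∘; map-id; map-id-local; map-cong-local; upTo-∷ʳ; length-upTo; length-applyUpTo; filter-++; ++-assoc; ++-identityʳ; ∷-injective)
open import Data.List.Relation.Binary.BagAndSetEquality using (∼bag⇒↭)
open import Data.List.Relation.Binary.Permutation.Propositional using (_↭_)
import Data.List.Relation.Binary.Permutation.Propositional.Properties as Permutation
open import Data.List.Relation.Unary.All as All using (All; []; _∷_)
import Data.List.Relation.Unary.All.Properties as AllP
open import Data.List.Relation.Unary.AllPairs using ([]; _∷_)
open import Data.List.Relation.Unary.Any using (here; there)
open import Data.List.Relation.Unary.Linked as Linked using (Linked; []; [-]; _∷_)
open import Data.List.Relation.Unary.Linked.Properties using (Linked⇒All)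
open import Data.List.Relation.Unary.Unique.Propositional using (Unique)
import Data.List.Relation.Unary.Unique.Propositional.Properties as Unique
open import Data.Nat
open import Data.Nat.Divisibility using (divides)
open import Data.Nat.DivMod using (m*n/n≡m; m<n*o⇒m/o<n; /-monoˡ-≤; +-distrib-/-∣ˡ)
open import Data.Nat.ListAction using (sum)
open import Data.Nat.ListAction.Properties using (sum-++; sum-↭)
open import Data.Nat.Properties
open import Data.Nat.Solver using (module +-*-Solver)
open import Data.Product using (_×_; _,_; ∃; proj₁; proj₂)
open import Data.Sum using (_⊎_; inj₁; inj₂)
open import Function using (_∘_; Equivalence; mk⇔)
open import Relation.Binary.PropositionalEquality
open import Relation.Nullary using (¬_; yes; no; does; Dec; contradiction)

-- Relabelling makes the bijection uniform. If c is the partner of the vertex `N`, exchanging the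
-- labels c and `N + 1` turns {`N`, c} into the block {`N`, `N + 1`}, which is easily dropped or
-- added; the same exchange restores the labels. So c is always the partner of `N`, and c = `N + 1`
-- is the extra symbol. For an old vertex c, the edge {c, p c} becomes the path c, `N`, `N + 1`, p
-- c: connections among old vertices are unchanged and one component gains two vertices. The
-- coset-type is the output of a program (bounded search, least representatives, sorting). Search is
-- replaced by an induction principle for connectivity, and order by multiplicities, written as sums
-- of indicators. Raising k shifts one unit of multiplicity from k to k + 1; stating this additively
-- and for positive parts only makes k = 0 the creation of a part 1. Raises at two different k
-- disagree at one more than the larger k, so k is determined. That the old type is contained in the
-- new one rests on the fact that sorting preserves rowwise inequalities.

-- Booleans, indicators and finite sums

T-ext : ∀ {a b} → (T a → T b) → (T b → T a) → a ≡ b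
T-ext {true}  {true}  f g = refl
T-ext {true}  {false} f g = ⊥-elim (f _)
T-ext {false} {true}  f g = ⊥-elim (g _)
T-ext {false} {false} f g = refl

T⇒≡true : ∀ {a} → T a → a ≡ true
T⇒≡true {true} _ = refl

¬T⇒≡false : ∀ {a} → ¬ T a → a ≡ false
¬T⇒≡false {true}  h = ⊥-elim (h _)
¬T⇒≡false {false} _ = refl

T-not⁻ : ∀ {a} → T (not a) → ¬ T a
T-not⁻ {false} _ ()

T-not⁺ : ∀ {a} → ¬ T a → T (not a)
T-not⁺ {true}  h = h _
T-not⁺ {false} _ = _

∧⁺ : ∀ {a b} → T a → T b → T (a ∧ b)
∧⁺ x y = Equivalence.from T-∧ (x , y)

∧⁻ : ∀ {a b} → T (a ∧ b) → T a × T b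
∧⁻ = Equivalence.to T-∧

∨⁺ : ∀ {a b} → T a ⊎ T b → T (a ∨ b)
∨⁺ = Equivalence.from T-∨

∨⁻ : ∀ {a b} → T (a ∨ b) → T a ⊎ T b
∨⁻ = Equivalence.to T-∨

≡ᵇ-refl : ∀ n → (n ≡ᵇ n) ≡ true
≡ᵇ-refl n = T⇒≡true (≡⇒≡ᵇ n n refl)

≢⇒≡ᵇ-false : ∀ {m n} → m ≢ n → (m ≡ᵇ n) ≡ false
≢⇒≡ᵇ-false {m} {n} m≢n = ¬T⇒≡false (m≢n ∘ ≡ᵇ⇒≡ m n)

⟦_⟧ : Bool → ℕ
⟦ true  ⟧ = 1
⟦ false ⟧ = 0

⟦⟧-∧ : ∀ a b → ⟦ a ∧ b ⟧ ≡ ⟦ a ⟧ * ⟦ b ⟧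
⟦⟧-∧ true  b = sym (+-identityʳ _)
⟦⟧-∧ false b = refl

∑ : {A : Set} → List A → (A → ℕ) → ℕ
∑ xs f = sum (map f xs)

module _ {A : Set} where

  ∑-cong : ∀ (xs : List A) {f g} → (∀ {x} → x ∈ xs → f x ≡ g x) → ∑ xs f ≡ ∑ xs g
  ∑-cong []       h = refl
  ∑-cong (x ∷ xs) h = cong₂ _+_ (h (here refl)) (∑-cong xs (h ∘ there))

  ∑-mono : ∀ (xs : List A) {f g} → (∀ {x} → x ∈ xs → f x ≤ g x) → ∑ xs f ≤ ∑ xs g
  ∑-mono []       h = z≤n
  ∑-mono (x ∷ xs) h = +-mono-≤ (h (here refl)) (∑-mono xs (h ∘ there))

  ∑-zero : ∀ (xs : List A) → ∑ xs (λ _ → 0) ≡ 0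
  ∑-zero []       = refl
  ∑-zero (x ∷ xs) = ∑-zero xs

  ∑-one : ∀ (xs : List A) → ∑ xs (λ _ → 1) ≡ length xs
  ∑-one []       = refl
  ∑-one (x ∷ xs) = cong suc (∑-one xs)

  ∑-+ : ∀ (xs : List A) f g → ∑ xs (λ x → f x + g x) ≡ ∑ xs f + ∑ xs g
  ∑-+ []       f g = refl
  ∑-+ (x ∷ xs) f g rewrite ∑-+ xs f g = +-interchange (f x) (g x) (∑ xs f) (∑ xs g)
    where
    +-interchange : ∀ a b c d → a + b + (c + d) ≡ a + c + (b + d)
    +-interchange = solve 4 (λ a b c d → a :+ b :+ (c :+ d) := a :+ c :+ (b :+ d)) refl
      where open +-*-Solver

  ∑-*ˡ : ∀ (xs : List A) k f → ∑ xs (λ x → k * f x) ≡ k * ∑ xs f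
  ∑-*ˡ []       k f = sym (*-zeroʳ k)
  ∑-*ˡ (x ∷ xs) k f = trans (cong (k * f x +_) (∑-*ˡ xs k f)) (sym (*-distribˡ-+ k (f x) (∑ xs f)))

  ∑-*ʳ : ∀ (xs : List A) k f → ∑ xs (λ x → f x * k) ≡ ∑ xs f * k
  ∑-*ʳ xs k f = trans (∑-cong xs (λ {x} _ → *-comm (f x) k)) (trans (∑-*ˡ xs k f) (*-comm k _))

  ∑-++ : ∀ (xs ys : List A) f → ∑ (xs ++ ys) f ≡ ∑ xs f + ∑ ys f
  ∑-++ xs ys f = trans (cong sum (map-++ f xs ys)) (sum-++ (map f xs) (map f ys))

  ∑-↭ : ∀ {xs ys : List A} f → xs ↭ ys → ∑ xs f ≡ ∑ ys f
  ∑-↭ f p = sum-↭ (Permutation.map⁺ f p)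

  ∑-filter : ∀ (xs : List A) {P : A → Set} (P? : ∀ x → Dec (P x)) f →
             ∑ (filter P? xs) f ≡ ∑ xs (λ x → ⟦ does (P? x) ⟧ * f x)
  ∑-filter []       P? f = refl
  ∑-filter (x ∷ xs) P? f with does (P? x)
  ... | true  = cong₂ _+_ (sym (+-identityʳ (f x))) (∑-filter xs P? f)
  ... | false = ∑-filter xs P? f

  ∑-filterᵇ : ∀ (xs : List A) b f → ∑ (filterᵇ b xs) f ≡ ∑ xs (λ x → ⟦ b x ⟧ * f x)
  ∑-filterᵇ xs b f = ∑-filter xs (T? ∘ b) f

  length-filterᵇ : ∀ (xs : List A) b → length (filterᵇ b xs) ≡ ∑ xs (⟦_⟧ ∘ b)
  length-filterᵇ xs b = trans (sym (∑-one (filterᵇ b xs)))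
    (trans (∑-filterᵇ xs b (λ _ → 1)) (∑-cong xs (λ _ → *-identityʳ _)))

∑-map : ∀ {A B : Set} (g : A → B) xs f → ∑ (map g xs) f ≡ ∑ xs (f ∘ g)
∑-map g xs f = cong sum (sym (map-∘ xs))

∑-swap : ∀ {A B : Set} (xs : List A) (ys : List B) (f : A → B → ℕ) →
         ∑ xs (λ x → ∑ ys (f x)) ≡ ∑ ys (λ y → ∑ xs (λ x → f x y))
∑-swap []       ys f = sym (∑-zero ys)
∑-swap (x ∷ xs) ys f = trans (cong (∑ ys (f x) +_) (∑-swap xs ys f)) (sym (∑-+ ys (f x) (λ y → ∑ xs (λ x → f x y))))

∑-upTo-suc : ∀ n f → ∑ (upTo (suc n)) f ≡ ∑ (upTo n) f + f n
∑-upTo-suc n f = trans (cong (λ l → ∑ l f) (sym (upTo-∷ʳ n)))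
  (trans (∑-++ (upTo n) (n ∷ []) f) (cong (∑ (upTo n) f +_) (+-identityʳ (f n))))

countB-∑ : ∀ N f → countB N f ≡ ∑ (upTo N) (⟦_⟧ ∘ f)
countB-∑ N f = length-filterᵇ (upTo N) f

anyB-suc : ∀ n f → anyB (suc n) f ≡ anyB n f ∨ f n
anyB-suc n f = trans (cong (or ∘ map f) (sym (upTo-∷ʳ n))) (or-∷ʳ (upTo n))
  where
  or-∷ʳ : ∀ l → or (map f (l ++ n ∷ [])) ≡ or (map f l) ∨ f n
  or-∷ʳ []      = ∨-identityʳ (f n)
  or-∷ʳ (x ∷ l) = trans (cong (f x ∨_) (or-∷ʳ l)) (sym (∨-assoc (f x) _ (f n)))

anyB⁻ : ∀ N f → T (anyB N f) → ∃ λ u → u < N × T (f u)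
anyB⁻ (suc N) f h with ∨⁻ (subst T (anyB-suc N f) h)
... | inj₁ r = let u , u<N , fu = anyB⁻ N f r in u , m<n⇒m<1+n u<N , fu
... | inj₂ r = N , ≤-refl , r

anyB⁺ : ∀ N f {u} → u < N → T (f u) → T (anyB N f)
anyB⁺ (suc N) f u<N fu with m<1+n⇒m<n∨m≡n u<N
... | inj₁ u<N′ = subst T (sym (anyB-suc N f)) (∨⁺ (inj₁ (anyB⁺ N f u<N′ fu)))
... | inj₂ refl = subst T (sym (anyB-suc N f)) (∨⁺ {anyB N f} (inj₂ fu))

anyB-cong : ∀ N {f g} → (∀ {u} → u < N → f u ≡ g u) → anyB N f ≡ anyB N g
anyB-cong N {f} {g} h = T-ext
  (λ t → let u , u<N , fu = anyB⁻ N f t in anyB⁺ N g u<N (subst T (h u<N) fu))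
  (λ t → let u , u<N , gu = anyB⁻ N g t in anyB⁺ N f u<N (subst T (sym (h u<N)) gu))

allB⁻ : ∀ N f → T (allB N f) → ∀ {u} → u < N → T (f u)
allB⁻ N f h u<N = go (upTo N) h (∈-upTo⁺ u<N)
  where
  go : ∀ l → T (and (map f l)) → ∀ {u} → u ∈ l → T (f u)
  go (x ∷ l) h (here refl) = proj₁ (∧⁻ h)
  go (x ∷ l) h (there i)   = go l (proj₂ (∧⁻ {f x} h)) i

allB⁺ : ∀ N f → (∀ {u} → u < N → T (f u)) → T (allB N f)
allB⁺ N f h = go (upTo N) (h ∘ ∈-upTo⁻)
  where
  go : ∀ l → (∀ {u} → u ∈ l → T (f u)) → T (and (map f l))
  go []      h = _
  go (x ∷ l) h = ∧⁺ (h (here refl)) (go l (h ∘ there))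

-- The first u with f u is the only one counted on the left.
∑-first : ∀ N f → ∑ (upTo N) (λ u → ⟦ f u ∧ not (anyB u f) ⟧) ≡ ⟦ anyB N f ⟧
∑-first zero    f = refl
∑-first (suc N) f = begin
  ∑ (upTo (suc N)) (λ u → ⟦ f u ∧ not (anyB u f) ⟧)                          ≡⟨ ∑-upTo-suc N _ ⟩
  ∑ (upTo N) (λ u → ⟦ f u ∧ not (anyB u f) ⟧) + ⟦ f N ∧ not (anyB N f) ⟧   ≡⟨ cong (_+ ⟦ f N ∧ not (anyB N f) ⟧) (∑-first N f) ⟩
  ⟦ anyB N f ⟧ + ⟦ f N ∧ not (anyB N f) ⟧                                   ≡⟨ disjoint (anyB N f) (f N) ⟩
  ⟦ anyB N f ∨ f N ⟧                                                         ≡⟨ cong ⟦_⟧ (anyB-suc N f) ⟨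
  ⟦ anyB (suc N) f ⟧                                                         ∎
  where
  open ≡-Reasoning
  disjoint : ∀ a b → ⟦ a ⟧ + ⟦ b ∧ not a ⟧ ≡ ⟦ a ∨ b ⟧
  disjoint true  true  = refl
  disjoint true  false = refl
  disjoint false true  = refl
  disjoint false false = refl

⟦⟧-mono : ∀ {a b} → (T a → T b) → ⟦ a ⟧ ≤ ⟦ b ⟧
⟦⟧-mono {false}        h = z≤n
⟦⟧-mono {true} {true}  h = ≤-refl
⟦⟧-mono {true} {false} h = ⊥-elim (h _)

extend-last : ∀ {N} {P : ℕ → Set} → (∀ {u} → u < N → P u) → P N → ∀ {u} → u < suc N → P u
extend-last h hN u<1+N with m<1+n⇒m<n∨m≡n u<1+N
... | inj₁ u<N  = h u<N
... | inj₂ refl = hN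

-- A growing family of vertex sets either stops growing or gains a vertex; with cardinality as the
-- measure, this is the termination argument for reachability.
∑-mono-strict : ∀ N {f g : ℕ → Bool} → (∀ {u} → T (f u) → T (g u)) →
                (∀ {u} → u < N → T (g u) → T (f u)) ⊎
                (∑ (upTo N) (⟦_⟧ ∘ f) < ∑ (upTo N) (⟦_⟧ ∘ g))
∑-mono-strict zero    f⇒g = inj₁ λ ()
∑-mono-strict (suc N) {f} {g} f⇒g
  rewrite ∑-upTo-suc N (⟦_⟧ ∘ f) | ∑-upTo-suc N (⟦_⟧ ∘ g)
  with ∑-mono-strict N f⇒g
... | inj₂ lt = inj₂ (+-mono-<-≤ lt (⟦⟧-mono f⇒g))
... | inj₁ g⇒f with f N in fN | g N in gN
-- The two predicates agree below `N`, so the strict gap comes from the single vertex `N`.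
...   | false | true  = inj₂ (+-mono-≤-< (∑-mono (upTo N) (λ i → ≤-reflexive (cong ⟦_⟧ (T-ext f⇒g (g⇒f (∈-upTo⁻ i)))))) (s≤s z≤n))
...   | true  | _     = inj₁ (extend-last {P = λ u → T (g u) → T (f u)} g⇒f λ _ → subst T (sym fN) _)
...   | false | false = inj₁ (extend-last {P = λ u → T (g u) → T (f u)} g⇒f λ gN′ → ⊥-elim (subst T gN gN′))

-- Connected components

module _ (p : List ℕ) (N v : ℕ) where

  Saturated : ℕ → Set
  Saturated t = ∀ {w} → w < N → T (reach p N (suc t) v w) → T (reach p N t v w)

  reach-suc⁻ : ∀ t {w} → T (reach p N (suc t) v w) →
               T (reach p N t v w) ⊎ ∃ λ u → u < N × T (reach p N t v u) × T (adjᵇ p u w)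
  reach-suc⁻ t {w} r with ∨⁻ {reach p N t v w} r
  ... | inj₁ r = inj₁ r
  ... | inj₂ s = let u , u<N , h = anyB⁻ N _ s in inj₂ (u , u<N , ∧⁻ {reach p N t v u} h)

  reach-step : ∀ t {u w} → u < N → T (reach p N t v u) → T (adjᵇ p u w) → T (reach p N (suc t) v w)
  reach-step t {u} {w} u<N r a = ∨⁺ {reach p N t v w} (inj₂ (anyB⁺ N _ u<N (∧⁺ {reach p N t v u} r a)))

  Saturated-suc : ∀ t → Saturated t → Saturated (suc t)
  Saturated-suc t sat w<N r with reach-suc⁻ (suc t) r
  ... | inj₁ r = r
  ... | inj₂ (u , u<N , r , a) = reach-step t u<N (sat u<N r) a

  -- A reachable set that is not yet saturated gains a vertex at every step.
  Saturated-or-large : ∀ t → Saturated t ⊎ t ≤ ∑ (upTo N) (λ w → ⟦ reach p N t v w ⟧)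
  Saturated-or-large zero = inj₂ z≤n
  Saturated-or-large (suc t) with Saturated-or-large t
  ... | inj₁ sat = inj₁ (Saturated-suc t sat)
  ... | inj₂ large with ∑-mono-strict N {reach p N t v} {reach p N (suc t) v} (λ r → ∨⁺ (inj₁ r))
  ...   | inj₁ sat = inj₁ (Saturated-suc t sat)
  ...   | inj₂ lt  = inj₂ (≤-<-trans large lt)

  ∑-upTo-⟦⟧≤ : ∀ (f : ℕ → Bool) → ∑ (upTo N) (⟦_⟧ ∘ f) ≤ N
  ∑-upTo-⟦⟧≤ f = ≤-trans (∑-mono (upTo N) (λ {x} _ → ⟦⟧≤1 (f x)))
    (≤-reflexive (trans (∑-one (upTo N)) (length-upTo N)))
    where
    ⟦⟧≤1 : ∀ b → ⟦ b ⟧ ≤ 1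
    ⟦⟧≤1 true  = ≤-refl
    ⟦⟧≤1 false = z≤n

  -- If the set were still growing after `N` steps, it would hold at least `N` vertices and its
  -- successor more than `N`. Hence the step bound in `connᵇ` suffices and connectivity is closed
  -- under adjacency.
  Saturated-N : Saturated N
  Saturated-N with Saturated-or-large N
  ... | inj₁ sat = sat
  ... | inj₂ large with ∑-mono-strict N {reach p N N v} {reach p N (suc N) v} (λ r → ∨⁺ (inj₁ r))
  ...   | inj₁ sat = sat
  ...   | inj₂ lt  = ⊥-elim (<⇒≱ (≤-<-trans large lt) (∑-upTo-⟦⟧≤ (reach p N (suc N) v)))

  reach-ind : (P : ℕ → Set) → (∀ {u w} → u < N → w < N → T (adjᵇ p u w) → P u → P w) → P v →
              ∀ t {w} → w < N → T (reach p N t v w) → P w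
  reach-ind P closed Pv zero {w} w<N r = subst P (≡ᵇ⇒≡ v w r) Pv
  reach-ind P closed Pv (suc t) w<N r with reach-suc⁻ t r
  ... | inj₁ r = reach-ind P closed Pv t w<N r
  ... | inj₂ (u , u<N , r , a) = closed u<N w<N a (reach-ind P closed Pv t u<N r)

  reach-refl : ∀ t → T (reach p N t v v)
  reach-refl zero    = ≡⇒≡ᵇ v v refl
  reach-refl (suc t) = ∨⁺ (inj₁ (reach-refl t))

-- The content of `isPairPartitionᵇ` for a partner function rather than a list, so that it can be
-- carried along pointwise equality and conjugation.
record Matching (N : ℕ) (q : ℕ → ℕ) : Set where
  field
    bounded     : ∀ {v} → v < N → q v < N
    involutive  : ∀ {v} → v < N → q (q v) ≡ v
    fixedFree   : ∀ {v} → v < N → q v ≢ v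

module Graph (N : ℕ) (p : List ℕ) (matching : Matching N (part p)) where

  open Matching matching

  conn : ℕ → ℕ → Bool
  conn = connᵇ p N

  Conn : ℕ → ℕ → Set
  Conn v w = T (conn v w)

  conn-refl : ∀ v → Conn v v
  conn-refl v = reach-refl p N v N

  -- Saturation absorbs the extra step along the edge of a fixed pair. `adjᵇ` excludes `u` = `w`, so
  -- that case is treated separately.
  conn-bond : ∀ {v u w} → u < N → w < N → u / 2 ≡ w / 2 → Conn v u → Conn v w
  conn-bond {v} {u} {w} u<N w<N e r with u ≟ w
  ... | yes refl = r
  ... | no  u≢w  = Saturated-N p N v w<N (reach-step p N v N u<N r (∨⁺ (inj₁
    (∧⁺ (≡⇒≡ᵇ (u / 2) (w / 2) e) (T-not⁺ (u≢w ∘ ≡ᵇ⇒≡ u w))))))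

  conn-partner : ∀ {v u} → u < N → Conn v u → Conn v (part p u)
  conn-partner {v} {u} u<N r = Saturated-N p N v (bounded u<N) (reach-step p N v N u<N r
    (∨⁺ {(u / 2 ≡ᵇ part p u / 2) ∧ _} (inj₂ (∨⁺ (inj₁ (≡⇒≡ᵇ (part p u) _ refl))))))

  -- A block occurs in `adjᵇ` in both orientations; involutivity turns the second into a step from a
  -- vertex to its partner, so two closure conditions are enough.
  conn-ind : (P : ℕ → Set) →
             (∀ {u w} → u < N → w < N → u / 2 ≡ w / 2 → P u → P w) →
             (∀ {u} → u < N → P u → P (part p u)) →
             ∀ {v w} → w < N → P v → Conn v w → P w
  conn-ind P bond partner {v} w<N Pv = reach-ind p N v P closed Pv N w<N
    where
    closed : ∀ {u w} → u < N → w < N → T (adjᵇ p u w) → P u → P w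
    closed {u} {w} u<N w<N a Pu with ∨⁻ {(u / 2 ≡ᵇ w / 2) ∧ _} a
    ... | inj₁ b = bond u<N w<N (≡ᵇ⇒≡ (u / 2) (w / 2) (proj₁ (∧⁻ b))) Pu
    ... | inj₂ b with ∨⁻ {part p u ≡ᵇ w} b
    ...   | inj₁ c = subst P (≡ᵇ⇒≡ _ w c) (partner u<N Pu)
    ...   | inj₂ c = subst P (trans (cong (part p) (sym (≡ᵇ⇒≡ _ u c))) (involutive w<N)) (partner u<N Pu)

  conn-trans : ∀ {u v w} → w < N → Conn u v → Conn v w → Conn u w
  conn-trans {u} w<N = conn-ind (Conn u) conn-bond conn-partner w<N

  -- Induction from `v` keeps the property of being connected back to `v`, because every fixed pair
  -- and every partner step can be walked backwards.
  conn-sym : ∀ {v w} → v < N → w < N → Conn v w → Conn w v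
  conn-sym {v} {w} v<N w<N = conn-ind (λ x → Conn x v)
    (λ {x} {y} x<N y<N e c → conn-trans v<N (conn-bond y<N x<N (sym e) (conn-refl y)) c)
    (λ {x} x<N c → conn-trans v<N
      (subst (Conn (part p x)) (involutive x<N) (conn-partner (bounded x<N) (conn-refl (part p x)))) c)
    w<N (conn-refl v)

  conn-cong : ∀ {u v w} → u < N → v < N → w < N → Conn u v → conn u w ≡ conn v w
  conn-cong u<N v<N w<N c = T-ext (conn-trans w<N (conn-sym u<N v<N c)) (conn-trans w<N c)

  isRep : ℕ → Bool
  isRep = isRepᵇ p N

  half : ℕ → ℕ
  half v = compSize p N v / 2

  reps : List ℕ
  reps = filterᵇ isRep (upTo N)

  halves : List ℕ
  halves = map half reps

  reps<N : ∀ {r} → r ∈ reps → r < N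
  reps<N r∈ = ∈-upTo⁻ (proj₁ (∈-filter⁻ _ {xs = upTo N} r∈))

  compSize-∑ : ∀ v → compSize p N v ≡ ∑ (upTo N) (λ w → ⟦ conn v w ⟧)
  compSize-∑ v = countB-∑ N (conn v)

  compSize-cong : ∀ {u v} → u < N → v < N → Conn u v → compSize p N u ≡ compSize p N v
  compSize-cong {u} {v} u<N v<N c = trans (compSize-∑ u) (trans
    (∑-cong (upTo N) (λ i → cong ⟦_⟧ (conn-cong u<N v<N (∈-upTo⁻ i) c))) (sym (compSize-∑ v)))

  -- A representative connected to `a` is the least vertex of the component of `a`, so `∑-first`
  -- counts exactly one.
  ∑-reps : ∀ {a} → a < N → ∑ reps (λ r → ⟦ conn r a ⟧) ≡ 1
  ∑-reps {a} a<N = begin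
    ∑ reps (λ r → ⟦ conn r a ⟧)                                          ≡⟨ ∑-filterᵇ (upTo N) isRep _ ⟩
    ∑ (upTo N) (λ r → ⟦ isRep r ⟧ * ⟦ conn r a ⟧)                        ≡⟨ ∑-cong (upTo N) (λ i → least (∈-upTo⁻ i)) ⟩
    ∑ (upTo N) (λ r → ⟦ conn a r ∧ not (anyB r (conn a)) ⟧)              ≡⟨ ∑-first N (conn a) ⟩
    ⟦ anyB N (conn a) ⟧                                                  ≡⟨ cong ⟦_⟧ (T⇒≡true (anyB⁺ N (conn a) a<N (conn-refl a))) ⟩
    1                                                                    ∎
    where
    open ≡-Reasoning
    least : ∀ {r} → r < N → ⟦ isRep r ⟧ * ⟦ conn r a ⟧ ≡ ⟦ conn a r ∧ not (anyB r (conn a)) ⟧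
    least {r} r<N = trans (*-comm ⟦ isRep r ⟧ _) (trans (sym (⟦⟧-∧ (conn r a) (isRep r)))
      (cong ⟦_⟧ (T-ext
        (λ t → let c , i = ∧⁻ {conn r a} t in
               ∧⁺ (conn-sym r<N a<N c) (subst (T ∘ not) (same c) i))
        (λ t → let c , i = ∧⁻ {conn a r} t ; c′ = conn-sym a<N r<N c in
               ∧⁺ c′ (subst (T ∘ not) (sym (same c′)) i)))))
      where
      same : Conn r a → anyB r (conn r) ≡ anyB r (conn a)
      same c = anyB-cong r (λ u<r → conn-cong r<N a<N (<-trans u<r r<N) c)

  -- By `∑-reps` the indicators `conn r a` form a partition of unity, and `half` is constant on
  -- components. `F` is arbitrary so that indicators of a half-size can be inserted.
  half-∑-reps : ∀ (F : ℕ → ℕ) {a} → a < N → F (half a) ≡ ∑ reps (λ r → ⟦ conn r a ⟧ * F (half r))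
  half-∑-reps F {a} a<N = begin
    F (half a)                                  ≡⟨ *-identityˡ _ ⟨
    1 * F (half a)                              ≡⟨ cong (_* F (half a)) (∑-reps a<N) ⟨
    ∑ reps (λ r → ⟦ conn r a ⟧) * F (half a)   ≡⟨ ∑-*ʳ reps (F (half a)) _ ⟨
    ∑ reps (λ r → ⟦ conn r a ⟧ * F (half a))   ≡⟨ ∑-cong reps (const-on-component ∘ reps<N) ⟩
    ∑ reps (λ r → ⟦ conn r a ⟧ * F (half r))   ∎
    where
    open ≡-Reasoning
    const-on-component : ∀ {r} → r < N → ⟦ conn r a ⟧ * F (half a) ≡ ⟦ conn r a ⟧ * F (half r)
    const-on-component {r} r<N with conn r a in e
    ... | false = refl
    ... | true  = cong (λ s → F (s / 2) + 0) (compSize-cong a<N r<N (conn-sym r<N a<N (subst T (sym e) _)))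

  -- Each vertex is charged to the representative of its component; exchanging the sums collects
  -- `compSize` vertices at each representative.
  ∑-vertices : ∀ (F : ℕ → ℕ) → ∑ (upTo N) (F ∘ half) ≡ ∑ reps (λ r → compSize p N r * F (half r))
  ∑-vertices F = begin
    ∑ (upTo N) (F ∘ half)                                          ≡⟨ ∑-cong (upTo N) (half-∑-reps F ∘ ∈-upTo⁻) ⟩
    ∑ (upTo N) (λ a → ∑ reps (λ r → ⟦ conn r a ⟧ * F (half r)))   ≡⟨ ∑-swap (upTo N) reps (λ a r → ⟦ conn r a ⟧ * F (half r)) ⟩
    ∑ reps (λ r → ∑ (upTo N) (λ a → ⟦ conn r a ⟧ * F (half r)))   ≡⟨ ∑-cong reps (λ {r} _ → trans (∑-*ʳ (upTo N) (F (half r)) (λ a → ⟦ conn r a ⟧)) (cong (_* F (half r)) (sym (compSize-∑ r)))) ⟩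
    ∑ reps (λ r → compSize p N r * F (half r))                     ∎
    where open ≡-Reasoning

-- Fixed pairs and the evenness of components

[2+n]/2≡1+n/2 : ∀ n → (2 + n) / 2 ≡ suc (n / 2)
[2+n]/2≡1+n/2 n = +-distrib-/-∣ˡ n {d = 2} (divides 1 refl)

m*2/2≡m : ∀ m → (m * 2) / 2 ≡ m
m*2/2≡m m = m*n/n≡m m 2

[1+m*2]/2≡m : ∀ m → (1 + m * 2) / 2 ≡ m
[1+m*2]/2≡m zero    = refl
[1+m*2]/2≡m (suc m) = trans ([2+n]/2≡1+n/2 (suc (m * 2))) (cong suc ([1+m*2]/2≡m m))

∑-bonds : ∀ m {f : ℕ → ℕ} → (∀ {k} → k < m → f (k * 2) ≡ f (suc (k * 2))) →
          ∑ (upTo (m * 2)) f ≡ ∑ (upTo m) (λ k → f (k * 2)) * 2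
∑-bonds zero            h = refl
∑-bonds (suc m) {f} h = begin
  ∑ (upTo (2 + m * 2)) f                                      ≡⟨ ∑-upTo-suc (suc (m * 2)) f ⟩
  ∑ (upTo (1 + m * 2)) f + f (suc (m * 2))                    ≡⟨ cong₂ _+_ (∑-upTo-suc (m * 2) f) (sym (h ≤-refl)) ⟩
  ∑ (upTo (m * 2)) f + f (m * 2) + f (m * 2)                  ≡⟨ cong (λ s → s + f (m * 2) + f (m * 2)) (∑-bonds m (h ∘ m<n⇒m<1+n)) ⟩
  ∑ (upTo m) (λ k → f (k * 2)) * 2 + f (m * 2) + f (m * 2)    ≡⟨ double (∑ (upTo m) (λ k → f (k * 2))) (f (m * 2)) ⟩
  (∑ (upTo m) (λ k → f (k * 2)) + f (m * 2)) * 2              ≡⟨ cong (_* 2) (∑-upTo-suc m (λ k → f (k * 2))) ⟨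
  ∑ (upTo (suc m)) (λ k → f (k * 2)) * 2                      ∎
  where
  open ≡-Reasoning
  double : ∀ a b → a * 2 + b + b ≡ (a + b) * 2
  double = solve 2 (λ a b → a :* con 2 :+ b :+ b := (a :+ b) :* con 2) refl
    where open +-*-Solver

module EvenGraph (m : ℕ) (p : List ℕ) (matching : Matching (m * 2) (part p)) where

  open Graph (m * 2) p matching

  -- A component contains both or neither of the vertices of each fixed pair, so its size is even
  -- and the division by 2 loses nothing.
  compSize-half : ∀ v → compSize p (m * 2) v ≡ half v * 2
  compSize-half v = trans even (cong (_* 2) (sym (trans (cong (_/ 2) even) (m*2/2≡m ∑evens))))
    where
    bond< : ∀ {k} → k < m → suc (k * 2) < m * 2
    bond< k<m = *-monoˡ-≤ 2 k<m
    ∑evens : ℕ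
    ∑evens = ∑ (upTo m) (λ k → ⟦ conn v (k * 2) ⟧)
    even : compSize p (m * 2) v ≡ ∑evens * 2
    even = trans (compSize-∑ v) (∑-bonds m (λ {k} k<m → cong ⟦_⟧ (T-ext
      (conn-bond (<-trans ≤-refl (bond< k<m)) (bond< k<m) (trans (m*2/2≡m k) (sym ([1+m*2]/2≡m k))))
      (conn-bond (bond< k<m) (<-trans ≤-refl (bond< k<m)) (trans ([1+m*2]/2≡m k) (sym (m*2/2≡m k)))))))

  -- With `F` constant this gives the size of the coset-type; with `F` an indicator it counts the
  -- vertices in components of a given half-size, the origin of the factor 2 k m_k.
  ∑-vertices-halves : ∀ (F : ℕ → ℕ) → ∑ (upTo (m * 2)) (F ∘ half) ≡ ∑ halves (λ x → x * 2 * F x)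
  ∑-vertices-halves F = trans (∑-vertices F) (trans
    (∑-cong reps (λ {r} _ → cong (_* F (half r)) (compSize-half r)))
    (sym (∑-map half reps (λ x → x * 2 * F x))))

  sum-halves : ∑ halves (λ x → x) ≡ m
  sum-halves = *-cancelʳ-≡ _ m 2 (begin
    ∑ halves (λ x → x) * 2          ≡⟨ ∑-*ʳ halves 2 (λ x → x) ⟨
    ∑ halves (λ x → x * 2)          ≡⟨ ∑-cong halves (λ {x} _ → sym (*-identityʳ (x * 2))) ⟩
    ∑ halves (λ x → x * 2 * 1)      ≡⟨ ∑-vertices-halves (λ _ → 1) ⟨
    ∑ (upTo (m * 2)) (λ _ → 1)      ≡⟨ ∑-one (upTo (m * 2)) ⟩
    length (upTo (m * 2))            ≡⟨ length-upTo (m * 2) ⟩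
    m * 2                            ∎)
    where open ≡-Reasoning

  half-positive : ∀ {v} → v < m * 2 → 1 ≤ half v
  half-positive {v} v<N with half v in e
  ... | suc _ = s≤s z≤n
  ... | zero  = ⊥-elim (<⇒≢ (component-nonempty v<N) (sym (trans (sym (compSize-∑ v)) (trans (compSize-half v) (cong (_* 2) e)))))
    where
    component-nonempty : ∀ {N} → v < N → 0 < ∑ (upTo N) (λ w → ⟦ conn v w ⟧)
    component-nonempty {suc N} v<N rewrite ∑-upTo-suc N (λ w → ⟦ conn v w ⟧) with m<1+n⇒m<n∨m≡n v<N
    ... | inj₁ v<N′ = ≤-trans (component-nonempty v<N′) (m≤m+n _ _)
    ... | inj₂ refl rewrite T⇒≡true (conn-refl v) = m≤n+m 1 _

-- Adding and deleting two vertices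

PairPartition : ℕ → List ℕ → Set
PairPartition N p = length p ≡ N × Matching N (part p)

pairPartition⁻ : ∀ N p → T (isPairPartitionᵇ N p) → PairPartition N p
pairPartition⁻ N p t = ≡ᵇ⇒≡ (length p) N (proj₁ (∧⁻ t)) , record
  { bounded    = λ {v} v<N → <ᵇ⇒< (part p v) N (proj₁ (∧⁻ (at v<N)))
  ; involutive = λ {v} v<N → ≡ᵇ⇒≡ (part p (part p v)) v (proj₁ (∧⁻ (proj₂ (∧⁻ {part p v <ᵇ N} (at v<N)))))
  ; fixedFree  = λ {v} v<N e → T-not⁻ (proj₂ (∧⁻ {part p (part p v) ≡ᵇ v} (proj₂ (∧⁻ {part p v <ᵇ N} (at v<N))))) (≡⇒≡ᵇ (part p v) v e)
  }
  where
  at : ∀ {v} → v < N → T ((part p v <ᵇ N) ∧ (part p (part p v) ≡ᵇ v) ∧ not (part p v ≡ᵇ v))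
  at = allB⁻ N _ (proj₂ (∧⁻ {length p ≡ᵇ N} t))

pairPartition⁺ : ∀ N p → PairPartition N p → T (isPairPartitionᵇ N p)
pairPartition⁺ N p (len , matching) = ∧⁺ (≡⇒≡ᵇ (length p) N len) (allB⁺ N _ λ {v} v<N →
  ∧⁺ (<⇒<ᵇ (bounded v<N)) (∧⁺ (≡⇒≡ᵇ (part p (part p v)) v (involutive v<N)) (T-not⁺ (fixedFree v<N ∘ ≡ᵇ⇒≡ (part p v) v))))
  where open Matching matching

part-applyUpTo : ∀ f N {v} → v < N → part (applyUpTo f N) v ≡ f v
part-applyUpTo f (suc N) {zero}  _         = refl
part-applyUpTo f (suc N) {suc v} (s≤s v<N) = part-applyUpTo (f ∘ suc) N v<N

applyUpTo-cong : ∀ N {f g : ℕ → ℕ} → (∀ {v} → v < N → f v ≡ g v) → applyUpTo f N ≡ applyUpTo g N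
applyUpTo-cong zero    h = refl
applyUpTo-cong (suc N) h = cong₂ _∷_ (h (s≤s z≤n)) (applyUpTo-cong N (h ∘ s≤s))

applyUpTo-part : ∀ {N} p → length p ≡ N → applyUpTo (part p) N ≡ p
applyUpTo-part []      refl = refl
applyUpTo-part (x ∷ p) refl = cong (x ∷_) (applyUpTo-part p refl)

All-part⁺ : ∀ {P : ℕ → Set} p → (∀ {v} → v < length p → P (part p v)) → All P p
All-part⁺ []      h = []
All-part⁺ (x ∷ p) h = h (s≤s z≤n) ∷ All-part⁺ p (h ∘ s≤s)

-- Unfolding nested swaps would duplicate their arguments exponentially.
opaque

  swap : ℕ → ℕ → ℕ → ℕ
  swap a b v with v ≟ a | v ≟ b
  ... | yes _ | _     = b
  ... | no  _ | yes _ = a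
  ... | no  _ | no  _ = v

  swapˡ : ∀ a b → swap a b a ≡ b
  swapˡ a b with a ≟ a | a ≟ b
  ... | yes _   | _ = refl
  ... | no  a≢a | _ = contradiction refl a≢a

  swapʳ : ∀ a b → swap a b b ≡ a
  swapʳ a b with b ≟ a | b ≟ b
  ... | yes b≡a | _       = b≡a
  ... | no  _   | yes _   = refl
  ... | no  _   | no  b≢b = contradiction refl b≢b

  swap-other : ∀ {a b v} → v ≢ a → v ≢ b → swap a b v ≡ v
  swap-other {a} {b} {v} v≢a v≢b with v ≟ a | v ≟ b
  ... | yes v≡a | _       = contradiction v≡a v≢a
  ... | no  _   | yes v≡b = contradiction v≡b v≢b
  ... | no  _   | no  _   = refl

  swap-involutive : ∀ a b v → swap a b (swap a b v) ≡ v
  swap-involutive a b v with v ≟ a | v ≟ b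
  ... | yes v≡a | _       = trans (swapʳ a b) (sym v≡a)
  ... | no  _   | yes v≡b = trans (swapˡ a b) (sym v≡b)
  ... | no  v≢a | no  v≢b = swap-other v≢a v≢b

  swap-bounded : ∀ {a b v N} → a < N → b < N → v < N → swap a b v < N
  swap-bounded {a} {b} {v} a<N b<N v<N with v ≟ a | v ≟ b
  ... | yes _ | _     = b<N
  ... | no  _ | yes _ = a<N
  ... | no  _ | no  _ = v<N

Matching-cong : ∀ {N q q′} → (∀ {v} → v < N → q v ≡ q′ v) → Matching N q → Matching N q′
Matching-cong {N} {q} {q′} e matching = record
  { bounded    = λ v<N → subst (_< N) (e v<N) (bounded v<N)
  ; involutive = λ v<N → trans (cong q′ (sym (e v<N))) (trans (sym (e (bounded v<N))) (involutive v<N))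
  ; fixedFree  = λ v<N → fixedFree v<N ∘ trans (e v<N)
  }
  where open Matching matching

Matching-swap : ∀ {N q a b} → a < N → b < N → Matching N q → Matching N (swap a b ∘ q ∘ swap a b)
Matching-swap {N} {q} {a} {b} a<N b<N matching = record
  { bounded    = λ v<N → swap-bounded a<N b<N (bounded (swap-bounded a<N b<N v<N))
  ; involutive = λ {v} v<N → trans (cong (swap a b ∘ q) (swap-involutive a b _))
      (trans (cong (swap a b) (involutive (swap-bounded a<N b<N v<N))) (swap-involutive a b v))
  ; fixedFree  = λ {v} v<N e → fixedFree (swap-bounded a<N b<N v<N)
      (trans (sym (swap-involutive a b _)) (cong (swap a b) e))
  }
  where open Matching matching

opaque

  addBlock : ℕ → (ℕ → ℕ) → ℕ → ℕ
  addBlock N q v with v <? N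
  ... | yes _ = q v
  ... | no  _ = swap N (suc N) v

  addBlock-old : ∀ {N q v} → v < N → addBlock N q v ≡ q v
  addBlock-old {N} {v = v} v<N with v <? N
  ... | yes _   = refl
  ... | no  v≮N = contradiction v<N v≮N

  addBlock-N : ∀ {N q} → addBlock N q N ≡ suc N
  addBlock-N {N} with N <? N
  ... | yes N<N = contradiction N<N (<-irrefl refl)
  ... | no  _   = swapˡ N (suc N)

  addBlock-1+N : ∀ {N q} → addBlock N q (suc N) ≡ N
  addBlock-1+N {N} with suc N <? N
  ... | yes 1+N<N = contradiction (m<n⇒m<1+n 1+N<N) (<-irrefl refl)
  ... | no  _     = swapʳ N (suc N)

data Below2 (N : ℕ) : ℕ → Set where
  old  : ∀ {v} → v < N → Below2 N v
  N+0  : Below2 N N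
  N+1  : Below2 N (suc N)

below2 : ∀ {N v} → v < 2 + N → Below2 N v
below2 {N} {v} v<2+N with m<1+n⇒m<n∨m≡n v<2+N
... | inj₂ refl = N+1
... | inj₁ v<1+N with m<1+n⇒m<n∨m≡n v<1+N
...   | inj₂ refl = N+0
...   | inj₁ v<N  = old v<N

N<2+N : ∀ {N} → N < 2 + N
N<2+N = m<n⇒m<1+n ≤-refl

<N⇒<2+N : ∀ {N v} → v < N → v < 2 + N
<N⇒<2+N = m<n⇒m<1+n ∘ m<n⇒m<1+n

Matching-addBlock : ∀ {N q} → Matching N q → Matching (2 + N) (addBlock N q)
Matching-addBlock {N} {q} matching = record
  { bounded    = bound ∘ below2
  ; involutive = invol ∘ below2
  ; fixedFree  = free ∘ below2
  }
  where
  open Matching matching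
  bound : ∀ {v} → Below2 N v → addBlock N q v < 2 + N
  bound (old v<N) = subst (_< 2 + N) (sym (addBlock-old v<N)) (<N⇒<2+N (bounded v<N))
  bound N+0       = subst (_< 2 + N) (sym addBlock-N) ≤-refl
  bound N+1       = subst (_< 2 + N) (sym addBlock-1+N) N<2+N
  invol : ∀ {v} → Below2 N v → addBlock N q (addBlock N q v) ≡ v
  invol (old v<N) = trans (cong (addBlock N q) (addBlock-old v<N)) (trans (addBlock-old (bounded v<N)) (involutive v<N))
  invol N+0       = trans (cong (addBlock N q) addBlock-N) addBlock-1+N
  invol N+1       = trans (cong (addBlock N q) addBlock-1+N) addBlock-N
  free : ∀ {v} → Below2 N v → addBlock N q v ≢ v
  free (old v<N) e = fixedFree v<N (trans (sym (addBlock-old v<N)) e)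
  free N+0       e = 1+n≢n (trans (sym addBlock-N) e)
  free N+1       e = 1+n≢n (sym (trans (sym addBlock-1+N) e))

-- An old vertex matched to `N` or `N + 1` would be the partner of that vertex, yet these two are
-- partners of each other.
Matching-dropBlock : ∀ {N q} → Matching (2 + N) q → q N ≡ suc N → Matching N q
Matching-dropBlock {N} {q} matching qN = record
  { bounded    = λ v<N → bound v<N (below2 (bounded (<N⇒<2+N v<N))) refl
  ; involutive = involutive ∘ <N⇒<2+N
  ; fixedFree  = fixedFree ∘ <N⇒<2+N
  }
  where
  open Matching matching
  bound : ∀ {v w} → v < N → Below2 N w → q v ≡ w → w < N
  bound v<N (old w<N) _ = w<N
  bound v<N N+0 e = contradiction (trans (sym qN) (trans (cong q (sym e)) (involutive (<N⇒<2+N v<N)))) (<⇒≢ (m<n⇒m<1+n v<N) ∘ sym)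
  bound v<N N+1 e = contradiction (trans (sym (involutive N<2+N)) (trans (cong q (trans qN (sym e))) (involutive (<N⇒<2+N v<N)))) (<⇒≢ v<N ∘ sym)

-- For c < N, the block {c , p c} is replaced by {c , N} and {p c , N + 1};
-- for c = N + 1 the swap is trivial and the block {N , N + 1} is added.
extendF : ℕ → (ℕ → ℕ) → ℕ → ℕ → ℕ
extendF N q c = swap c (suc N) ∘ addBlock N q ∘ swap c (suc N)

extend : ℕ → List ℕ → ℕ → List ℕ
extend N p c = applyUpTo (extendF N (part p) c) (2 + N)

-- Once the labels `q N` and `N + 1` are exchanged, `N` is matched to `N + 1` and this block can be
-- cut off. The label `q N`, kept by `restrict`, is the choice that reverses the operation.
restrictF : ℕ → (ℕ → ℕ) → ℕ → ℕ
restrictF N q = swap (q N) (suc N) ∘ q ∘ swap (q N) (suc N)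

restrict : ℕ → List ℕ → List ℕ × ℕ
restrict N p = applyUpTo (restrictF N (part p)) N , part p N

-- The possible partners of `N`: an old vertex, or `N + 1` for the block {`N`, `N + 1`}. `N` itself
-- is left out because a matching has no fixed point.
choices : ℕ → List ℕ
choices N = upTo N ++ suc N ∷ []

Choice : ℕ → ℕ → Set
Choice N c = c < 2 + N × c ≢ N

∈-choices⁺ : ∀ {N c} → Choice N c → c ∈ choices N
∈-choices⁺ {N} (c<2+N , c≢N) with below2 c<2+N
... | old c<N = ∈-++⁺ˡ (∈-upTo⁺ c<N)
... | N+0     = contradiction refl c≢N
... | N+1     = ∈-++⁺ʳ (upTo N) (here refl)

∈-choices⁻ : ∀ {N c} → c ∈ choices N → Choice N c
∈-choices⁻ {N} c∈ with ∈-++⁻ (upTo N) c∈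
... | inj₁ i = <N⇒<2+N (∈-upTo⁻ i) , <⇒≢ (∈-upTo⁻ i)
... | inj₂ (here refl) = ≤-refl , 1+n≢n

extend-pairPartition : ∀ {N p c} → PairPartition N p → Choice N c → PairPartition (2 + N) (extend N p c)
extend-pairPartition {N} {p} {c} (_ , matching) (c<2+N , _) =
  length-applyUpTo (extendF N (part p) c) (2 + N) ,
  Matching-cong (λ v<2+N → sym (part-applyUpTo (extendF N (part p) c) (2 + N) v<2+N))
    (Matching-swap c<2+N ≤-refl (Matching-addBlock matching))

module _ {N : ℕ} {q : ℕ → ℕ} (matching : Matching (2 + N) q) where

  open Matching matching

  private
    τ : ℕ → ℕ
    τ = swap (q N) (suc N)

  restrictF-matching : Matching (2 + N) (restrictF N q)
  restrictF-matching = Matching-swap (bounded N<2+N) ≤-refl matching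

  restrictF-N : restrictF N q N ≡ suc N
  restrictF-N = trans (cong (τ ∘ q) (swap-other (fixedFree N<2+N ∘ sym) (1+n≢n ∘ sym))) (swapˡ (q N) (suc N))

  -- `r` is read off a list of length `N` and is controlled only below `N`. At `N` and `N + 1` both
  -- functions exchange the two new vertices, so they agree there too, and the two conjugations
  -- cancel.
  extendF-restrictF : ∀ {r} → (∀ {v} → v < N → r v ≡ restrictF N q v) →
                      ∀ {v} → v < 2 + N → extendF N r (q N) v ≡ q v
  extendF-restrictF {r} e {v} v<2+N = begin
    τ (addBlock N r (τ v))  ≡⟨ cong τ (addBlock-restrict (below2 (swap-bounded (bounded N<2+N) ≤-refl v<2+N))) ⟩
    τ (τ (q (τ (τ v))))     ≡⟨ swap-involutive (q N) (suc N) (q (τ (τ v))) ⟩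
    q (τ (τ v))             ≡⟨ cong q (swap-involutive (q N) (suc N) v) ⟩
    q v                     ∎
    where
    open ≡-Reasoning
    addBlock-restrict : ∀ {v} → Below2 N v → addBlock N r v ≡ restrictF N q v
    addBlock-restrict (old v<N) = trans (addBlock-old {q = r} v<N) (e v<N)
    addBlock-restrict N+0       = trans (addBlock-N {q = r}) (sym restrictF-N)
    addBlock-restrict N+1       = trans (addBlock-1+N {q = r}) (sym (trans (cong (restrictF N q) (sym restrictF-N))
      (Matching.involutive restrictF-matching N<2+N)))

restrict-pairPartition : ∀ {N p} → PairPartition (2 + N) p → PairPartition N (proj₁ (restrict N p))
restrict-pairPartition {N} {p} (_ , matching) = length-applyUpTo (restrictF N (part p)) N ,
  Matching-cong (λ v<N → sym (part-applyUpTo (restrictF N (part p)) N v<N))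
    (Matching-dropBlock (restrictF-matching matching) (restrictF-N matching))

restrict-choice : ∀ {N p} → PairPartition (2 + N) p → Choice N (proj₂ (restrict N p))
restrict-choice (_ , matching) = Matching.bounded matching N<2+N , Matching.fixedFree matching N<2+N

extend∘restrict : ∀ {N p} → PairPartition (2 + N) p →
                  extend N (proj₁ (restrict N p)) (proj₂ (restrict N p)) ≡ p
extend∘restrict {N} {p} (len , matching) = trans
  (applyUpTo-cong (2 + N) (extendF-restrictF matching (part-applyUpTo (restrictF N (part p)) N)))
  (applyUpTo-part p len)

extendF-at-N : ∀ {N q c} → c ≢ N → extendF N q c N ≡ c
extendF-at-N {N} {q} {c} c≢N = begin
  τ (addBlock N q (τ N))  ≡⟨ cong (τ ∘ addBlock N q) (swap-other (c≢N ∘ sym) (1+n≢n ∘ sym)) ⟩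
  τ (addBlock N q N)      ≡⟨ cong τ (addBlock-N {q = q}) ⟩
  τ (suc N)               ≡⟨ swapʳ c (suc N) ⟩
  c                       ∎
  where
  open ≡-Reasoning
  τ : ℕ → ℕ
  τ = swap c (suc N)

restrictF-extendF : ∀ {N q r c} → Choice N c → (∀ {v} → v < 2 + N → r v ≡ extendF N q c v) →
                    ∀ {v} → v < N → restrictF N r v ≡ q v
restrictF-extendF {N} {q} {r} {c} (c<2+N , c≢N) e {v} v<N = begin
  restrictF N r v                  ≡⟨ cong (λ c′ → swap c′ (suc N) (r (swap c′ (suc N) v))) (trans (e N<2+N) (extendF-at-N {q = q} c≢N)) ⟩
  τ (r (τ v))                      ≡⟨ cong τ (e (swap-bounded c<2+N ≤-refl (<N⇒<2+N v<N))) ⟩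
  τ (τ (addBlock N q (τ (τ v))))   ≡⟨ swap-involutive c (suc N) (addBlock N q (τ (τ v))) ⟩
  addBlock N q (τ (τ v))           ≡⟨ cong (addBlock N q) (swap-involutive c (suc N) v) ⟩
  addBlock N q v                   ≡⟨ addBlock-old {q = q} v<N ⟩
  q v                              ∎
  where
  open ≡-Reasoning
  τ : ℕ → ℕ
  τ = swap c (suc N)

restrict∘extend : ∀ {N p c} → PairPartition N p → Choice N c → restrict N (extend N p c) ≡ (p , c)
restrict∘extend {N} {p} {c} (len , _) choice = cong₂ _,_
  (trans (applyUpTo-cong N (restrictF-extendF {q = part p} choice at)) (applyUpTo-part p len))
  (trans (at N<2+N) (extendF-at-N {q = part p} (proj₂ choice)))
  where
  at : ∀ {v} → v < 2 + N → part (extend N p c) v ≡ extendF N (part p) c v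
  at = part-applyUpTo (extendF N (part p) c) (2 + N)

-- Coset-types of extensions

-- The boundary `m * 2` is even, so no fixed pair straddles it.
sameBond-old : ∀ m {u w} → u < m * 2 → u / 2 ≡ w / 2 → w < m * 2
sameBond-old m {u} {w} u<N e = ≰⇒> λ N≤w → <⇒≱ (m<n*o⇒m/o<n u<N)
  (≤-trans (≤-reflexive (sym (m*2/2≡m m))) (≤-trans (/-monoˡ-≤ 2 N≤w) (≤-reflexive (sym e))))

filterᵇ-cong : ∀ {f g : ℕ → Bool} xs → (∀ {x} → x ∈ xs → f x ≡ g x) → filterᵇ f xs ≡ filterᵇ g xs
filterᵇ-cong []       h = refl
filterᵇ-cong {f} {g} (x ∷ xs) h with f x | g x | h (here refl)
... | true  | true  | _ = cong (x ∷_) (filterᵇ-cong xs (h ∘ there))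
... | false | false | _ = filterᵇ-cong xs (h ∘ there)

upTo-2+ : ∀ N → upTo (2 + N) ≡ upTo N ++ N ∷ suc N ∷ []
upTo-2+ N = trans (sym (upTo-∷ʳ (suc N))) (trans (cong (_++ suc N ∷ []) (sym (upTo-∷ʳ N))) (++-assoc (upTo N) _ _))

module Extension (m : ℕ) (p : List ℕ) (pp : PairPartition (m * 2) p) where

  N : ℕ
  N = m * 2

  private
    q : ℕ → ℕ
    q = part p

  module Old = Graph N p (proj₂ pp)
  open Matching (proj₂ pp)

  module _ {c : ℕ} (choice : Choice N c) where

    private
      p′ : List ℕ
      p′ = extend N p c

    module New = Graph (2 + N) p′ (proj₂ (extend-pairPartition {p = p} pp choice))

    -- `isRepᵇ` inspects only smaller vertices, so vertices added at the end do not affect whether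
    -- an old vertex is a representative.
    isRep-old : (∀ {v w} → v < N → w < N → New.conn v w ≡ Old.conn v w) →
                ∀ {v} → v < N → New.isRep v ≡ Old.isRep v
    isRep-old e v<N = cong not (anyB-cong _ λ u<v → e v<N (<-trans u<v v<N))

    conn-N-1+N : New.Conn (suc N) N
    conn-N-1+N = New.conn-bond ≤-refl N<2+N (trans ([1+m*2]/2≡m m) (sym (m*2/2≡m m))) (New.conn-refl (suc N))

    isRep-1+N : New.isRep (suc N) ≡ false
    isRep-1+N = ¬T⇒≡false λ t → T-not⁻ t (anyB⁺ (suc N) (New.conn (suc N)) ≤-refl conn-N-1+N)

    compSize-split : ∀ v → compSize p′ (2 + N) v ≡
      ∑ (upTo N) (λ w → ⟦ New.conn v w ⟧) + (⟦ New.conn v N ⟧ + ⟦ New.conn v (suc N) ⟧)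
    compSize-split v = trans (New.compSize-∑ v) (trans (∑-upTo-suc (suc N) f)
      (trans (cong (_+ f (suc N)) (∑-upTo-suc N f)) (+-assoc (∑ (upTo N) f) (f N) (f (suc N)))))
      where
      f : ℕ → ℕ
      f w = ⟦ New.conn v w ⟧

    reps-split : (∀ {v w} → v < N → w < N → New.conn v w ≡ Old.conn v w) →
                 New.reps ≡ Old.reps ++ filterᵇ New.isRep (N ∷ suc N ∷ [])
    reps-split e = trans (cong (filterᵇ New.isRep) (upTo-2+ N)) (trans (filter-++ (T? ∘ New.isRep) (upTo N) _)
      (cong (_++ filterᵇ New.isRep (N ∷ suc N ∷ [])) (filterᵇ-cong (upTo N) (isRep-old e ∘ ∈-upTo⁻))))

  module Grow {a : ℕ} (a<N : a < N) where

    private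
      choice : Choice N a
      choice = <N⇒<2+N a<N , <⇒≢ a<N

      p′ : List ℕ
      p′ = extend N p a

    open New choice using (Conn; conn; conn-ind; conn-bond; conn-partner; conn-refl; conn-sym; isRep; half; reps; halves)

    partner : ∀ {v} → v < 2 + N → part p′ v ≡ swap a (suc N) (addBlock N q (swap a (suc N) v))
    partner = part-applyUpTo (extendF N q a) (2 + N)

    old≢1+N : ∀ {v} → v < N → v ≢ suc N
    old≢1+N v<N = <⇒≢ (m<n⇒m<1+n v<N)

    partner-a : part p′ a ≡ N
    partner-a = begin
      part p′ a                                            ≡⟨ partner (<N⇒<2+N a<N) ⟩
      swap a (suc N) (addBlock N q (swap a (suc N) a))     ≡⟨ cong (swap a (suc N) ∘ addBlock N q) (swapˡ a (suc N)) ⟩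
      swap a (suc N) (addBlock N q (suc N))                ≡⟨ cong (swap a (suc N)) (addBlock-1+N {q = q}) ⟩
      swap a (suc N) N                                     ≡⟨ swap-other (<⇒≢ a<N ∘ sym) (1+n≢n ∘ sym) ⟩
      N                                                    ∎
      where open ≡-Reasoning

    partner-qa : part p′ (q a) ≡ suc N
    partner-qa = begin
      part p′ (q a)                                        ≡⟨ partner (<N⇒<2+N (bounded a<N)) ⟩
      swap a (suc N) (addBlock N q (swap a (suc N) (q a))) ≡⟨ cong (swap a (suc N) ∘ addBlock N q) (swap-other (fixedFree a<N) (old≢1+N (bounded a<N))) ⟩
      swap a (suc N) (addBlock N q (q a))                  ≡⟨ cong (swap a (suc N)) (addBlock-old {q = q} (bounded a<N)) ⟩
      swap a (suc N) (q (q a))                             ≡⟨ cong (swap a (suc N)) (involutive a<N) ⟩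
      swap a (suc N) a                                     ≡⟨ swapˡ a (suc N) ⟩
      suc N                                                ∎
      where open ≡-Reasoning

    partner-N : part p′ N ≡ a
    partner-N = trans (partner N<2+N) (extendF-at-N {q = q} (<⇒≢ a<N))

    partner-1+N : part p′ (suc N) ≡ q a
    partner-1+N = trans (cong (part p′) (sym partner-qa))
      (Matching.involutive (proj₂ (extend-pairPartition {p = p} pp choice)) (<N⇒<2+N (bounded a<N)))

    partner-other : ∀ {u} → u < N → u ≢ a → u ≢ q a → part p′ u ≡ q u
    partner-other {u} u<N u≢a u≢qa = begin
      part p′ u                                            ≡⟨ partner (<N⇒<2+N u<N) ⟩
      swap a (suc N) (addBlock N q (swap a (suc N) u))     ≡⟨ cong (swap a (suc N) ∘ addBlock N q) (swap-other u≢a (old≢1+N u<N)) ⟩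
      swap a (suc N) (addBlock N q u)                      ≡⟨ cong (swap a (suc N)) (addBlock-old {q = q} u<N) ⟩
      swap a (suc N) (q u)                                 ≡⟨ swap-other (λ e → u≢qa (trans (sym (involutive u<N)) (cong q e))) (old≢1+N (bounded u<N)) ⟩
      q u                                                  ∎
      where open ≡-Reasoning

    -- Contracts the path `a`, `N`, `N + 1`, `q a` by sending both new vertices to `a`, so that
    -- connections of the new graph can be read in the old one.
    project : ℕ → ℕ
    project w with w <? N
    ... | yes _ = w
    ... | no  _ = a

    project-old : ∀ {w} → w < N → project w ≡ w
    project-old {w} w<N with w <? N
    ... | yes _   = refl
    ... | no  w≮N = contradiction w<N w≮N

    project-new : ∀ {w} → N ≤ w → project w ≡ a
    project-new {w} N≤w with w <? N
    ... | yes w<N = contradiction N≤w (<⇒≱ w<N)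
    ... | no  _   = refl

    project-N : project N ≡ a
    project-N = project-new ≤-refl

    project-1+N : project (suc N) ≡ a
    project-1+N = project-new (n≤1+n N)

    -- After the contraction every new edge is stationary, an old edge, or a step between `a` and
    -- `q a`, which are joined in the old graph.
    conn⇒old : ∀ {v w} → v < N → w < 2 + N → Conn v w → Old.Conn v (project w)
    conn⇒old {v} v<N w<2+N = conn-ind P bond step w<2+N (subst (Old.Conn v) (sym (project-old v<N)) (Old.conn-refl v))
      where
      P : ℕ → Set
      P w = Old.Conn v (project w)
      bond : ∀ {u w} → u < 2 + N → w < 2 + N → u / 2 ≡ w / 2 → P u → P w
      bond {u} {w} _ _ e Pu = by-cases (u <? N)
        where
        by-cases : Dec (u < N) → P w
        by-cases (yes u<N) = subst (Old.Conn v) (sym (project-old w<N))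
          (Old.conn-bond u<N w<N e (subst (Old.Conn v) (project-old u<N) Pu))
          where
          w<N : w < N
          w<N = sameBond-old m u<N e
        by-cases (no u≮N) = subst (Old.Conn v)
          (trans (project-new (≮⇒≥ u≮N)) (sym (project-new (≮⇒≥ (λ w<N → u≮N (sameBond-old m w<N (sym e))))))) Pu
      step′ : ∀ {u} → Below2 N u → P u → Dec (u ≡ a) → Dec (u ≡ q a) → P (part p′ u)
      step′ (old u<N) Pu (yes refl) _ =
        subst (Old.Conn v) (sym (trans (cong project partner-a) project-N)) (subst (Old.Conn v) (project-old a<N) Pu)
      step′ (old u<N) Pu (no _) (yes refl) =
        subst (Old.Conn v) (sym (trans (cong project partner-qa) project-1+N))
          (subst (Old.Conn v) (involutive a<N) (Old.conn-partner u<N (subst (Old.Conn v) (project-old u<N) Pu)))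
      step′ (old u<N) Pu (no u≢a) (no u≢qa) =
        subst (Old.Conn v) (sym (trans (cong project (partner-other u<N u≢a u≢qa)) (project-old (bounded u<N))))
          (Old.conn-partner u<N (subst (Old.Conn v) (project-old u<N) Pu))
      step′ N+0 Pu _ _ =
        subst (Old.Conn v) (trans project-N (sym (trans (cong project partner-N) (project-old a<N)))) Pu
      step′ N+1 Pu _ _ =
        subst (Old.Conn v) (sym (trans (cong project partner-1+N) (project-old (bounded a<N))))
          (Old.conn-partner a<N (subst (Old.Conn v) project-1+N Pu))
      step : ∀ {u} → u < 2 + N → P u → P (part p′ u)
      step {u} u<2+N Pu = step′ (below2 u<2+N) Pu (u ≟ a) (u ≟ q a)

    conn-N⇒1+N : ∀ {v} → Conn v N → Conn v (suc N)
    conn-N⇒1+N = conn-bond N<2+N ≤-refl (trans (m*2/2≡m m) (sym ([1+m*2]/2≡m m)))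

    conn-1+N⇒N : ∀ {v} → Conn v (suc N) → Conn v N
    conn-1+N⇒N = conn-bond ≤-refl N<2+N (trans ([1+m*2]/2≡m m) (sym (m*2/2≡m m)))

    conn-a⇒N : ∀ {v} → Conn v a → Conn v N
    conn-a⇒N {v} c = subst (Conn v) partner-a (conn-partner (<N⇒<2+N a<N) c)

    -- Only the old edge {`a`, `q a`} has disappeared, and it is replaced by the detour through `N`
    -- and `N + 1`, walked in either direction.
    old⇒conn : ∀ {v w} → v < N → w < N → Old.Conn v w → Conn v w
    old⇒conn {v} v<N w<N = Old.conn-ind (Conn v)
      (λ u<N w<N → conn-bond (<N⇒<2+N u<N) (<N⇒<2+N w<N))
      (λ {u} u<N c → step u<N c (u ≟ a) (u ≟ q a))
      w<N (conn-refl v)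
      where
      step : ∀ {u} → u < N → Conn v u → Dec (u ≡ a) → Dec (u ≡ q a) → Conn v (q u)
      step u<N c (yes refl) _ = subst (Conn v) partner-1+N (conn-partner ≤-refl (conn-N⇒1+N (conn-a⇒N c)))
      step u<N c (no _) (yes refl) = subst (Conn v) (trans partner-N (sym (involutive a<N)))
        (conn-partner N<2+N (conn-1+N⇒N (subst (Conn v) partner-qa (conn-partner (<N⇒<2+N u<N) c))))
      step u<N c (no u≢a) (no u≢qa) = subst (Conn v) (partner-other u<N u≢a u≢qa) (conn-partner (<N⇒<2+N u<N) c)

    conn-old : ∀ {v w} → v < N → w < N → conn v w ≡ Old.conn v w
    conn-old {v} v<N w<N = T-ext
      (λ c → subst (Old.Conn v) (project-old w<N) (conn⇒old v<N (<N⇒<2+N w<N) c))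
      (old⇒conn v<N w<N)

    conn-N : ∀ {v} → v < N → conn v N ≡ Old.conn v a
    conn-N {v} v<N = T-ext
      (λ c → subst (Old.Conn v) project-N (conn⇒old v<N N<2+N c))
      (conn-a⇒N ∘ old⇒conn v<N a<N)

    conn-1+N : ∀ {v} → v < N → conn v (suc N) ≡ Old.conn v a
    conn-1+N v<N = trans (T-ext conn-1+N⇒N conn-N⇒1+N) (conn-N v<N)

    -- The component of `v` receives both new vertices or neither, according to whether it contains
    -- `a`; two vertices raise the half-size by one.
    half-grow : ∀ {v} → v < N → half v ≡ Old.half v + ⟦ Old.conn v a ⟧
    half-grow {v} v<N = trans (cong (_/ 2) sizes) (add-pair (compSize p N v) (Old.conn v a))
      where
      sizes : compSize p′ (2 + N) v ≡ compSize p N v + (⟦ Old.conn v a ⟧ + ⟦ Old.conn v a ⟧)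
      sizes = trans (compSize-split choice v) (cong₂ _+_
        (trans (∑-cong (upTo N) (λ i → cong ⟦_⟧ (conn-old v<N (∈-upTo⁻ i)))) (sym (Old.compSize-∑ v)))
        (cong₂ (λ x y → ⟦ x ⟧ + ⟦ y ⟧) (conn-N v<N) (conn-1+N v<N)))
      add-pair : ∀ s b → (s + (⟦ b ⟧ + ⟦ b ⟧)) / 2 ≡ s / 2 + ⟦ b ⟧
      add-pair s true  = trans (cong (_/ 2) (+-comm s 2)) (trans ([2+n]/2≡1+n/2 s) (+-comm 1 (s / 2)))
      add-pair s false = trans (cong (_/ 2) (+-identityʳ s)) (sym (+-identityʳ (s / 2)))

    -- Both new vertices lie in the component of the smaller vertex `a`, so neither is least in it.
    reps-grow : reps ≡ Old.reps
    reps-grow = trans (reps-split choice conn-old) (trans (cong (Old.reps ++_) no-new) (++-identityʳ Old.reps))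
      where
      isRep-N : isRep N ≡ false
      isRep-N = ¬T⇒≡false λ t → T-not⁻ t (anyB⁺ N (conn N) a<N
        (conn-sym (<N⇒<2+N a<N) N<2+N (conn-a⇒N (conn-refl a))))
      no-new : filterᵇ isRep (N ∷ suc N ∷ []) ≡ []
      no-new rewrite isRep-N | isRep-1+N choice = refl

    halves-grow : halves ≡ map (λ r → Old.half r + ⟦ Old.conn r a ⟧) Old.reps
    halves-grow = trans (cong (map half) reps-grow) (map-cong-local (All.tabulate (half-grow ∘ Old.reps<N)))

  module Append where

    private
      choice : Choice N (suc N)
      choice = ≤-refl , 1+n≢n

      p′ : List ℕ
      p′ = extend N p (suc N)

    open New choice using (Conn; conn; conn-ind; conn-bond; conn-partner; conn-refl; conn-sym; isRep; half; reps; halves)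

    partner-old : ∀ {u} → u < N → part p′ u ≡ q u
    partner-old {u} u<N = begin
      part p′ u                                                          ≡⟨ part-applyUpTo (extendF N q (suc N)) (2 + N) (<N⇒<2+N u<N) ⟩
      swap (suc N) (suc N) (addBlock N q (swap (suc N) (suc N) u))       ≡⟨ cong (swap (suc N) (suc N) ∘ addBlock N q) (old-fixed u<N) ⟩
      swap (suc N) (suc N) (addBlock N q u)                              ≡⟨ cong (swap (suc N) (suc N)) (addBlock-old {q = q} u<N) ⟩
      swap (suc N) (suc N) (q u)                                         ≡⟨ old-fixed (bounded u<N) ⟩
      q u                                                                ∎
      where
      open ≡-Reasoning
      old-fixed : ∀ {v} → v < N → swap (suc N) (suc N) v ≡ v
      old-fixed v<N = swap-other (<⇒≢ (m<n⇒m<1+n v<N)) (<⇒≢ (m<n⇒m<1+n v<N))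

    -- The old vertices are closed under fixed pairs and partners, so a walk starting among them
    -- never leaves; `w < N` is part of the induction for this reason.
    conn⇒old : ∀ {v w} → v < N → w < 2 + N → Conn v w → w < N × Old.Conn v w
    conn⇒old {v} v<N w<2+N = conn-ind (λ w → w < N × Old.Conn v w)
      (λ _ _ e (u<N , c) → sameBond-old m u<N e , Old.conn-bond u<N (sameBond-old m u<N e) e c)
      (λ _ (u<N , c) → subst (λ w → w < N × Old.Conn v w) (sym (partner-old u<N)) (bounded u<N , Old.conn-partner u<N c))
      w<2+N (v<N , Old.conn-refl v)

    conn-old : ∀ {v w} → v < N → w < N → conn v w ≡ Old.conn v w
    conn-old {v} v<N w<N = T-ext (proj₂ ∘ conn⇒old v<N (<N⇒<2+N w<N))
      (Old.conn-ind (Conn v) (λ u<N w<N → conn-bond (<N⇒<2+N u<N) (<N⇒<2+N w<N))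
        (λ u<N c → subst (Conn v) (partner-old u<N) (conn-partner (<N⇒<2+N u<N) c)) w<N (conn-refl v))

    conn-new : ∀ {v w} → v < N → N ≤ w → w < 2 + N → conn v w ≡ false
    conn-new v<N N≤w w<2+N = ¬T⇒≡false λ c → <⇒≱ (proj₁ (conn⇒old v<N w<2+N c)) N≤w

    half-old : ∀ {v} → v < N → half v ≡ Old.half v
    half-old {v} v<N = cong (_/ 2) (trans (compSize-split choice v) (trans (cong₂ _+_
      (trans (∑-cong (upTo N) (λ i → cong ⟦_⟧ (conn-old v<N (∈-upTo⁻ i)))) (sym (Old.compSize-∑ v)))
      (cong₂ (λ x y → ⟦ x ⟧ + ⟦ y ⟧) (conn-new v<N ≤-refl N<2+N) (conn-new v<N (n≤1+n N) ≤-refl)))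
      (+-identityʳ _)))

    conn-N-old : ∀ {w} → w < N → conn N w ≡ false
    conn-N-old w<N = ¬T⇒≡false λ c →
      subst T (conn-new w<N ≤-refl N<2+N) (conn-sym N<2+N (<N⇒<2+N w<N) c)

    half-N : half N ≡ 1
    half-N = cong (_/ 2) (trans (compSize-split choice N) (cong₂ _+_
      (trans (∑-cong (upTo N) (λ i → cong ⟦_⟧ (conn-N-old (∈-upTo⁻ i)))) (∑-zero (upTo N)))
      (cong₂ (λ x y → ⟦ x ⟧ + ⟦ y ⟧) (T⇒≡true (conn-refl N))
        (T⇒≡true (conn-sym ≤-refl N<2+N (conn-N-1+N choice))))))

    reps-append : reps ≡ Old.reps ++ N ∷ []
    reps-append = trans (reps-split choice conn-old) (cong (Old.reps ++_) only-N)
      where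
      isRep-N : isRep N ≡ true
      isRep-N = T⇒≡true (T-not⁺ λ t → let u , u<N , c = anyB⁻ N (conn N) t in
        subst T (conn-N-old u<N) c)
      only-N : filterᵇ isRep (N ∷ suc N ∷ []) ≡ N ∷ []
      only-N rewrite isRep-N | isRep-1+N choice = refl

    halves-append : halves ≡ Old.halves ++ 1 ∷ []
    halves-append = trans (cong (map half) reps-append) (trans (map-++ half Old.reps (N ∷ []))
      (cong₂ (λ xs x → xs ++ x ∷ []) (map-cong-local (All.tabulate (half-old ∘ Old.reps<N))) half-N))

-- Sorted lists and multiplicities

Positive : List ℕ → Set
Positive = All (1 ≤_)

Descending : List ℕ → Set
Descending = Linked _≥_

-- A view of `insertDesc` that replaces its Boolean test by the inequality it decides.
data Insertion (x y : ℕ) (ys : List ℕ) : List ℕ → Set where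
  here  : y ≤ x → Insertion x y ys (x ∷ y ∷ ys)
  there : x < y → Insertion x y ys (y ∷ insertDesc x ys)

insertion : ∀ x y ys → Insertion x y ys (insertDesc x (y ∷ ys))
insertion x y ys with y ≤ᵇ x in e
... | true  = here (≤ᵇ⇒≤ y x (subst T (sym e) _))
... | false = there (≰⇒> λ y≤x → subst T e (≤⇒≤ᵇ y≤x))

-- Sums do not depend on order, and multiplicities are sums of indicators; this is how sorting is
-- removed from the later counts.
∑-insertDesc : ∀ x xs (f : ℕ → ℕ) → ∑ (insertDesc x xs) f ≡ f x + ∑ xs f
∑-insertDesc x []       f = refl
∑-insertDesc x (y ∷ ys) f with insertDesc x (y ∷ ys) | insertion x y ys
... | _ | here  _ = refl
... | _ | there _ = trans (cong (f y +_) (∑-insertDesc x ys f)) (rotate (f y) (f x) (∑ ys f))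
  where
  rotate : ∀ a b c → a + (b + c) ≡ b + (a + c)
  rotate = solve 3 (λ a b c → a :+ (b :+ c) := b :+ (a :+ c)) refl
    where open +-*-Solver

∑-sortDesc : ∀ xs (f : ℕ → ℕ) → ∑ (sortDesc xs) f ≡ ∑ xs f
∑-sortDesc []       f = refl
∑-sortDesc (x ∷ xs) f = trans (∑-insertDesc x (sortDesc xs) f) (cong (f x +_) (∑-sortDesc xs f))

All-insertDesc : ∀ {P : ℕ → Set} {x} xs → P x → All P xs → All P (insertDesc x xs)
All-insertDesc []       px []         = px ∷ []
All-insertDesc {x = x} (y ∷ ys) px (py ∷ pys) with insertDesc x (y ∷ ys) | insertion x y ys
... | _ | here  _ = px ∷ py ∷ pys
... | _ | there _ = py ∷ All-insertDesc ys px pys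

All-sortDesc : ∀ {P : ℕ → Set} {xs} → All P xs → All P (sortDesc xs)
All-sortDesc []                     = []
All-sortDesc {xs = x ∷ xs} (px ∷ pxs) = All-insertDesc (sortDesc xs) px (All-sortDesc pxs)

insertDesc-descending : ∀ x {xs} → Descending xs → Descending (insertDesc x xs)
insertDesc-descending x []  = [-]
insertDesc-descending x {y ∷ []} [-] with insertDesc x (y ∷ []) | insertion x y []
... | _ | here  y≤x = y≤x ∷ [-]
... | _ | there x<y = <⇒≤ x<y ∷ [-]
insertDesc-descending x {y ∷ z ∷ zs} (y≥z ∷ d) with insertDesc x (y ∷ z ∷ zs) | insertion x y (z ∷ zs)
... | _ | here  y≤x = y≤x ∷ y≥z ∷ d
... | _ | there x<y with insertDesc x (z ∷ zs) | insertion x z zs | insertDesc-descending x d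
...   | _ | here  _ | d′ = <⇒≤ x<y ∷ d′
...   | _ | there _ | d′ = y≥z ∷ d′

sortDesc-descending : ∀ xs → Descending (sortDesc xs)
sortDesc-descending []       = []
sortDesc-descending (x ∷ xs) = insertDesc-descending x (sortDesc-descending xs)

insertDesc-head : ∀ {x xs} → Descending (x ∷ xs) → insertDesc x xs ≡ x ∷ xs
insertDesc-head [-] = refl
insertDesc-head {x} {y ∷ ys} (x≥y ∷ _) with insertDesc x (y ∷ ys) | insertion x y ys
... | _ | here  _   = refl
... | _ | there x<y = contradiction x≥y (<⇒≱ x<y)

-- Insertion is monotone in the inserted part as well as in the list, which lets rowwise comparison
-- survive sorting.
insertDesc-⊆Y : ∀ {x y xs ys} → x ≤ y → Descending xs → Descending ys → xs ⊆Y ys →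
                insertDesc x xs ⊆Y insertDesc y ys
insertDesc-⊆Y x≤y dxs dys ([]⊆ {[]}) = ∷⊆∷ x≤y []⊆
insertDesc-⊆Y {y = y} x≤y dxs dys ([]⊆ {b ∷ bs}) with insertDesc y (b ∷ bs) | insertion y b bs
... | _ | here  _   = ∷⊆∷ x≤y []⊆
... | _ | there y<b = ∷⊆∷ (≤-trans x≤y (<⇒≤ y<b)) []⊆
insertDesc-⊆Y x≤y dxs dys (∷⊆ z≤n s) = ∷⊆∷ x≤y (∷⊆ z≤n s)
insertDesc-⊆Y {x} {y} x≤y dxs dys (∷⊆∷ {a} {b} {as} {bs} a≤b s)
  with insertDesc x (a ∷ as) | insertion x a as | insertDesc y (b ∷ bs) | insertion y b bs
... | _ | here  a≤x | _ | here  b≤y = ∷⊆∷ x≤y (∷⊆∷ a≤b s)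
-- When the two insertions stop at different depths, the intact descending list is read as its own
-- head inserted into its tail, and the induction is applied with that head as the inserted part.
... | _ | here  a≤x | _ | there y<b = ∷⊆∷ (≤-trans x≤y (<⇒≤ y<b))
  (subst (_⊆Y insertDesc y bs) (insertDesc-head dxs) (insertDesc-⊆Y (≤-trans a≤x x≤y) (Linked.tail dxs) (Linked.tail dys) s))
... | _ | there x<a | _ | here  b≤y = ∷⊆∷ (≤-trans a≤b b≤y)
  (subst (insertDesc x as ⊆Y_) (insertDesc-head dys) (insertDesc-⊆Y (≤-trans (<⇒≤ x<a) a≤b) (Linked.tail dxs) (Linked.tail dys) s))
... | _ | there x<a | _ | there y<b = ∷⊆∷ a≤b (insertDesc-⊆Y x≤y (Linked.tail dxs) (Linked.tail dys) s)

-- Serves both kinds of extension: `zs` holds the part 1 of a new block, and is empty when a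
-- component grows. In both cases the old type is contained in the new one.
sortDesc-⊆Y : ∀ {A : Set} {f g : A → ℕ} → (∀ r → f r ≤ g r) → ∀ rs zs →
              sortDesc (map f rs) ⊆Y sortDesc (map g rs ++ zs)
sortDesc-⊆Y h []       zs = []⊆
sortDesc-⊆Y {f = f} {g} h (r ∷ rs) zs = insertDesc-⊆Y (h r)
  (sortDesc-descending (map f rs)) (sortDesc-descending (map g rs ++ zs)) (sortDesc-⊆Y h rs zs)

multiplicity-∑ : ∀ xs y → multiplicity xs y ≡ ∑ xs (λ x → ⟦ x ≡ᵇ y ⟧)
multiplicity-∑ xs y = length-filterᵇ xs (_≡ᵇ y)

multiplicity-∷ : ∀ x xs y → multiplicity (x ∷ xs) y ≡ ⟦ x ≡ᵇ y ⟧ + multiplicity xs y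
multiplicity-∷ x xs y with x ≡ᵇ y
... | true  = refl
... | false = refl

multiplicity-sortDesc : ∀ xs y → multiplicity (sortDesc xs) y ≡ multiplicity xs y
multiplicity-sortDesc xs y = trans (multiplicity-∑ (sortDesc xs) y)
  (trans (∑-sortDesc xs _) (sym (multiplicity-∑ xs y)))

multiplicity-head : ∀ x xs → multiplicity (x ∷ xs) x ≡ suc (multiplicity xs x)
multiplicity-head x xs = trans (multiplicity-∷ x xs x) (cong (λ b → ⟦ b ⟧ + multiplicity xs x) (≡ᵇ-refl x))

multiplicity-above : ∀ {b x ys} → All (b ≥_) ys → b < x → multiplicity ys x ≡ 0
multiplicity-above {x = x} []                 b<x = refl
multiplicity-above {x = x} {y ∷ ys} (b≥y ∷ h) b<x = trans (multiplicity-∷ y ys x)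
  (cong₂ (λ c n → ⟦ c ⟧ + n) (≢⇒≡ᵇ-false (<⇒≢ (≤-<-trans b≥y b<x))) (multiplicity-above h b<x))

SameParts : List ℕ → List ℕ → Set
SameParts xs ys = ∀ k → multiplicity xs (suc k) ≡ multiplicity ys (suc k)

head-≤ : ∀ {x y xs ys} → 1 ≤ x → Descending (y ∷ ys) → SameParts (x ∷ xs) (y ∷ ys) → x ≤ y
head-≤ {suc k} {y} {xs} {ys} _ d same = ≮⇒≥ λ y<x → 1+n≢0 (begin
  suc (multiplicity xs (suc k))    ≡⟨ multiplicity-head (suc k) xs ⟨
  multiplicity (suc k ∷ xs) (suc k) ≡⟨ same k ⟩
  multiplicity (y ∷ ys) (suc k)    ≡⟨ multiplicity-above (Linked⇒All (λ p q → ≤-trans q p) ≤-refl d) y<x ⟩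
  0                                ∎)
  where open ≡-Reasoning

-- The head of a descending list is its largest part, so equal multiplicities force equal heads,
-- which cancel. Positivity is needed because `SameParts` says nothing about zeros.
descending-unique : ∀ {xs ys} → Positive xs → Positive ys → Descending xs → Descending ys →
                    SameParts xs ys → xs ≡ ys
descending-unique [] [] _ _ _ = refl
descending-unique {ys = suc k ∷ ys} [] (_ ∷ _) _ _ same =
  contradiction (trans (sym (multiplicity-head (suc k) ys)) (sym (same k))) 1+n≢0
descending-unique {suc k ∷ xs} (_ ∷ _) [] _ _ same =
  contradiction (trans (sym (multiplicity-head (suc k) xs)) (same k)) 1+n≢0
descending-unique {x ∷ xs} {y ∷ ys} (px ∷ pxs) (py ∷ pys) dx dy same
  with ≤-antisym (head-≤ px dy same) (head-≤ py dx (sym ∘ same))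
... | refl = cong (x ∷_) (descending-unique pxs pys (Linked.tail dx) (Linked.tail dy) λ k →
  +-cancelˡ-≡ ⟦ x ≡ᵇ suc k ⟧ _ _
    (trans (sym (multiplicity-∷ x xs (suc k))) (trans (same k) (multiplicity-∷ x ys (suc k)))))

-- ys arises from xs by turning a part x into x + 1 (by adding a part 1 if x = 0).
Raise : ℕ → List ℕ → List ℕ → Set
Raise x xs ys = ∀ k → multiplicity ys (suc k) + ⟦ x ≡ᵇ suc k ⟧ ≡ multiplicity xs (suc k) + ⟦ x ≡ᵇ k ⟧

-- At the multiplicity of `x′` + 1, a raise at `x′` adds one while a raise at a smaller `x` changes
-- nothing.
Raise-≮ : ∀ {x x′ xs ys} → Raise x xs ys → Raise x′ xs ys → x ≮ x′
Raise-≮ {x} {x′} {xs} {ys} r r′ x<x′ = 1+n≢0 (+-cancelˡ-≡ (multiplicity xs (suc x′)) 1 0 (begin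
  multiplicity xs (suc x′) + 1                       ≡⟨ cong (λ b → multiplicity xs (suc x′) + ⟦ b ⟧) (≡ᵇ-refl x′) ⟨
  multiplicity xs (suc x′) + ⟦ x′ ≡ᵇ x′ ⟧            ≡⟨ r′ x′ ⟨
  multiplicity ys (suc x′) + ⟦ x′ ≡ᵇ suc x′ ⟧        ≡⟨ cong (λ b → multiplicity ys (suc x′) + ⟦ b ⟧) (trans (≢⇒≡ᵇ-false (1+n≢n {x′} ∘ sym)) (sym (≢⇒≡ᵇ-false (<⇒≢ (m<n⇒m<1+n x<x′))))) ⟩
  multiplicity ys (suc x′) + ⟦ x ≡ᵇ suc x′ ⟧         ≡⟨ r x′ ⟩
  multiplicity xs (suc x′) + ⟦ x ≡ᵇ x′ ⟧             ≡⟨ cong (λ b → multiplicity xs (suc x′) + ⟦ b ⟧) (≢⇒≡ᵇ-false (<⇒≢ x<x′)) ⟩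
  multiplicity xs (suc x′) + 0                       ∎))
  where open ≡-Reasoning

Raise-unique : ∀ {x x′ xs ys} → Raise x xs ys → Raise x′ xs ys → x ≡ x′
Raise-unique {xs = xs} {ys} r r′ =
  ≤-antisym (≮⇒≥ (Raise-≮ {xs = xs} {ys} r′ r)) (≮⇒≥ (Raise-≮ {xs = xs} {ys} r r′))

Raise-∷ : ∀ {x xs ys} z → Raise x xs ys → Raise x (z ∷ xs) (z ∷ ys)
Raise-∷ {x} {xs} {ys} z r k = begin
  multiplicity (z ∷ ys) (suc k) + ⟦ x ≡ᵇ suc k ⟧                    ≡⟨ cong (_+ ⟦ x ≡ᵇ suc k ⟧) (multiplicity-∷ z ys (suc k)) ⟩
  ⟦ z ≡ᵇ suc k ⟧ + multiplicity ys (suc k) + ⟦ x ≡ᵇ suc k ⟧         ≡⟨ +-assoc ⟦ z ≡ᵇ suc k ⟧ _ _ ⟩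
  ⟦ z ≡ᵇ suc k ⟧ + (multiplicity ys (suc k) + ⟦ x ≡ᵇ suc k ⟧)       ≡⟨ cong (⟦ z ≡ᵇ suc k ⟧ +_) (r k) ⟩
  ⟦ z ≡ᵇ suc k ⟧ + (multiplicity xs (suc k) + ⟦ x ≡ᵇ k ⟧)           ≡⟨ +-assoc ⟦ z ≡ᵇ suc k ⟧ _ _ ⟨
  ⟦ z ≡ᵇ suc k ⟧ + multiplicity xs (suc k) + ⟦ x ≡ᵇ k ⟧             ≡⟨ cong (_+ ⟦ x ≡ᵇ k ⟧) (multiplicity-∷ z xs (suc k)) ⟨
  multiplicity (z ∷ xs) (suc k) + ⟦ x ≡ᵇ k ⟧                        ∎
  where open ≡-Reasoning

Raise-head : ∀ x xs → Raise x (x ∷ xs) (suc x ∷ xs)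
Raise-head x xs k = begin
  multiplicity (suc x ∷ xs) (suc k) + ⟦ x ≡ᵇ suc k ⟧             ≡⟨ cong (_+ ⟦ x ≡ᵇ suc k ⟧) (multiplicity-∷ (suc x) xs (suc k)) ⟩
  ⟦ x ≡ᵇ k ⟧ + multiplicity xs (suc k) + ⟦ x ≡ᵇ suc k ⟧          ≡⟨ rotate ⟦ x ≡ᵇ k ⟧ (multiplicity xs (suc k)) ⟦ x ≡ᵇ suc k ⟧ ⟩
  ⟦ x ≡ᵇ suc k ⟧ + multiplicity xs (suc k) + ⟦ x ≡ᵇ k ⟧          ≡⟨ cong (_+ ⟦ x ≡ᵇ k ⟧) (multiplicity-∷ x xs (suc k)) ⟨
  multiplicity (x ∷ xs) (suc k) + ⟦ x ≡ᵇ k ⟧                     ∎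
  where
  open ≡-Reasoning
  rotate : ∀ a b c → a + b + c ≡ c + b + a
  rotate = solve 3 (λ a b c → a :+ b :+ c := c :+ b :+ a) refl
    where open +-*-Solver

Raise-sortDesc : ∀ {x xs ys} → Raise x xs ys → Raise x (sortDesc xs) (sortDesc ys)
Raise-sortDesc {x} {xs} {ys} r k rewrite multiplicity-sortDesc xs (suc k) | multiplicity-sortDesc ys (suc k) = r k

Raise-functional : ∀ {x xs ys zs} → Raise x xs ys → Raise x xs zs → SameParts ys zs
Raise-functional {x} r r′ k = +-cancelʳ-≡ ⟦ x ≡ᵇ suc k ⟧ _ _ (trans (r k) (sym (r′ k)))

-- Diagrams that differ by one box

⊆Y⇒sum≤ : ∀ {xs ys} → xs ⊆Y ys → sum xs ≤ sum ys
⊆Y⇒sum≤ []⊆          = z≤n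
⊆Y⇒sum≤ (∷⊆ z≤n s)   = ⊆Y⇒sum≤ s
⊆Y⇒sum≤ (∷⊆∷ x≤y s)  = +-mono-≤ x≤y (⊆Y⇒sum≤ s)

-- Rowwise inequalities with equal totals must all be equalities.
⊆Y∧sum≡⇒≡ : ∀ {xs ys} → Positive xs → Positive ys → xs ⊆Y ys → sum xs ≡ sum ys → xs ≡ ys
⊆Y∧sum≡⇒≡ _         []            []⊆          _ = refl
⊆Y∧sum≡⇒≡ _         (s≤s z≤n ∷ _) []⊆          ()
⊆Y∧sum≡⇒≡ (() ∷ _)  _             (∷⊆ z≤n _)   _
⊆Y∧sum≡⇒≡ (_ ∷ pxs) (_ ∷ pys)     (∷⊆∷ {x} {y} {xs} {ys} x≤y s) e = cong₂ _∷_ x≡y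
  (⊆Y∧sum≡⇒≡ pxs pys s (+-cancelˡ-≡ x _ _ (trans e (cong (_+ sum ys) (sym x≡y)))))
  where
  x≡y : x ≡ y
  x≡y = ≤-antisym x≤y (+-cancelʳ-≤ (sum ys) y x (≤-trans (≤-reflexive (sym e)) (+-monoʳ-≤ x (⊆Y⇒sum≤ s))))

findRow-shift : ∀ x y xs ys L i → findRow (x ∷ xs) (y ∷ ys) L (suc i) ≡ suc (findRow xs ys L i)
findRow-shift x y xs ys zero    i = refl
findRow-shift x y xs ys (suc L) i with part ys i ≡ᵇ suc (part xs i)
... | true  = refl
... | false = findRow-shift x y xs ys L (suc i)

-- The μ_- of the theorem; for a new row it is 0, by the default value of `part` beyond the end of
-- `μ`.
raisedPart : List ℕ → List ℕ → ℕ
raisedPart μ la = part μ (findRow μ la (length la) 0)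

-- Equal rows are peeled off and restored by `Raise-∷` until the longer row is met. If `μ` runs out
-- before that, one unit of size is left, so what remains of `la` is a single part 1, a raise of 0.
raisedPart-Raise : ∀ {μ la} → Positive μ → Positive la → μ ⊆Y la → sum la ≡ suc (sum μ) →
                   Raise (raisedPart μ la) μ la
raisedPart-Raise {la = zero ∷ _}          _ (() ∷ _)      []⊆ e
raisedPart-Raise {la = suc zero ∷ []}     _ _             []⊆ e = λ { zero → refl ; (suc k) → refl }
raisedPart-Raise {la = suc zero ∷ y ∷ ys} _ (_ ∷ s≤s z≤n ∷ _) []⊆ ()
raisedPart-Raise {la = suc (suc _) ∷ _}   _ _             []⊆ ()
raisedPart-Raise pμ pla (∷⊆ _ _) ()
raisedPart-Raise (_ ∷ pxs) (_ ∷ pys) (∷⊆∷ {x} {y} {xs} {ys} x≤y s) e with m≤n⇒m<n∨m≡n x≤y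
... | inj₂ refl rewrite ≢⇒≡ᵇ-false (1+n≢n {x} ∘ sym) | findRow-shift x x xs ys (length ys) 0 =
  Raise-∷ {raisedPart xs ys} {xs} {ys} x (raisedPart-Raise pxs pys s (+-cancelˡ-≡ x _ _ (trans e (sym (+-suc x (sum xs))))))
-- The later rows do not shrink either, so the one extra unit of size forces `y` = `x` + 1; the
-- remaining rows then have equal sums and coincide.
... | inj₁ x<y with ≤-antisym x<y (+-cancelʳ-≤ (sum ys) y (suc x) (≤-trans (≤-reflexive e) (+-monoʳ-≤ (suc x) (⊆Y⇒sum≤ s))))
...   | refl rewrite ≡ᵇ-refl x
               | ⊆Y∧sum≡⇒≡ pxs pys s (sym (+-cancelˡ-≡ (suc x) _ _ e)) = Raise-head x ys

-- Merges the two cases of `coef` into the shape in which extensions are counted: the first term for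
-- old vertices, the second for the new block. For each value of the raised part at most one is
-- nonzero.
coef-raisedPart : ∀ μ la → coef μ la ≡
  raisedPart μ la * 2 * multiplicity μ (raisedPart μ la) + ⟦ 0 ≡ᵇ raisedPart μ la ⟧
coef-raisedPart μ la with part μ (findRow μ la (length la) 0)
... | zero  = refl
... | suc k = trans (cong (_* multiplicity μ (suc k)) (*-comm 2 (suc k))) (sym (+-identityʳ _))

listEqᵇ⇒≡ : ∀ xs ys → T (listEqᵇ xs ys) → xs ≡ ys
listEqᵇ⇒≡ []       []       _ = refl
listEqᵇ⇒≡ (x ∷ xs) (y ∷ ys) t =
  cong₂ _∷_ (≡ᵇ⇒≡ x y (proj₁ (∧⁻ t))) (listEqᵇ⇒≡ xs ys (proj₂ (∧⁻ {x ≡ᵇ y} t)))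

listEqᵇ-refl : ∀ xs → T (listEqᵇ xs xs)
listEqᵇ-refl []       = _
listEqᵇ-refl (x ∷ xs) = ∧⁺ (≡⇒≡ᵇ x x refl) (listEqᵇ-refl xs)

-- Equality with `la` makes `la` a raise at both `x` and `x₀`, and the raised part is unique.
-- Conversely, raises at the same part have the same positive multiplicities, which determine a
-- descending list of positive parts.
listEqᵇ-raise : ∀ {x x₀ xs ys la} → Raise x xs ys → Positive ys → Positive la → Descending la →
                Raise x₀ (sortDesc xs) la → listEqᵇ (sortDesc ys) la ≡ (x ≡ᵇ x₀)
listEqᵇ-raise {x} {x₀} {xs} {ys} {la} r pys pla dla r₀ = T-ext
  (λ t → ≡⇒≡ᵇ x x₀ (Raise-unique {xs = sortDesc xs} {la}
    (subst (Raise x (sortDesc xs)) (listEqᵇ⇒≡ (sortDesc ys) la t) sorted) r₀))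
  (λ t → subst (T ∘ listEqᵇ (sortDesc ys)) (same (≡ᵇ⇒≡ x x₀ t)) (listEqᵇ-refl (sortDesc ys)))
  where
  sorted : Raise x (sortDesc xs) (sortDesc ys)
  sorted = Raise-sortDesc {x} {xs} {ys} r
  same : x ≡ x₀ → sortDesc ys ≡ la
  same refl = descending-unique (All-sortDesc pys) pla (sortDesc-descending ys) dla
    (Raise-functional {x} {sortDesc xs} {sortDesc ys} {la} sorted r₀)

-- Enumeration and summation

∑-cartesianProduct : ∀ {A B : Set} (xs : List A) (ys : List B) (f : A × B → ℕ) →
                     ∑ (cartesianProduct xs ys) f ≡ ∑ xs (λ x → ∑ ys (λ y → f (x , y)))
∑-cartesianProduct []       ys f = refl
∑-cartesianProduct (x ∷ xs) ys f = trans (∑-++ (map (x ,_) ys) (cartesianProduct xs ys) f)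
  (cong₂ _+_ (∑-map (x ,_) ys f) (∑-cartesianProduct xs ys f))

-- Puts the enumerations into a form to which the membership and uniqueness lemmas for
-- `cartesianProductWith` apply.
concatMap-cartesianProductWith : ∀ {A B C : Set} (f : A → B → C) xs ys →
  concatMap (λ x → map (f x) ys) xs ≡ cartesianProductWith f xs ys
concatMap-cartesianProductWith f []       ys = refl
concatMap-cartesianProductWith f (x ∷ xs) ys = cong (map (f x) ys ++_) (concatMap-cartesianProductWith f xs ys)

lists-suc : ∀ N K → lists (suc N) K ≡ cartesianProductWith _∷_ (upTo K) (lists N K)
lists-suc N K = concatMap-cartesianProductWith _∷_ (upTo K) (lists N K)

lists-unique : ∀ N K → Unique (lists N K)
lists-unique zero    K = [] ∷ []
lists-unique (suc N) K = subst Unique (sym (lists-suc N K))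
  (Unique.cartesianProductWith⁺ _∷_ ∷-injective (Unique.upTo⁺ K) (lists-unique N K))

∈-lists : ∀ {K p} → All (_< K) p → p ∈ lists (length p) K
∈-lists []                      = here refl
∈-lists {K} {x ∷ p} (x<K ∷ p<K) = subst (x ∷ p ∈_) (sym (lists-suc (length p) K))
  (∈-cartesianProductWith⁺ _∷_ (∈-upTo⁺ x<K) (∈-lists p<K))

nonemptyLists : ℕ → ℕ → List (List ℕ)
nonemptyLists L k = cartesianProductWith (λ x → suc x ∷_) (upTo k) (listsUpTo L k)

listsUpTo-suc : ∀ L k → listsUpTo (suc L) k ≡ [] ∷ nonemptyLists L k
listsUpTo-suc L k = cong ([] ∷_) (concatMap-cartesianProductWith (λ x → suc x ∷_) (upTo k) (listsUpTo L k))

listsUpTo-unique : ∀ L k → Unique (listsUpTo L k)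
listsUpTo-unique zero    k = [] ∷ []
listsUpTo-unique (suc L) k = subst Unique (sym (listsUpTo-suc L k))
  (All.tabulate []∉ ∷ Unique.cartesianProductWith⁺ (λ x → suc x ∷_)
    (λ e → suc-injective (proj₁ (∷-injective e)) , proj₂ (∷-injective e)) (Unique.upTo⁺ k) (listsUpTo-unique L k))
  where
  []∉ : ∀ {l} → l ∈ nonemptyLists L k → [] ≢ l
  []∉ l∈ refl with ∈-cartesianProductWith⁻ (λ x → suc x ∷_) (upTo k) (listsUpTo L k) l∈
  ... | ()

∈-listsUpTo : ∀ {k μ} L → Positive μ → length μ ≤ L → All (_≤ k) μ → μ ∈ listsUpTo L k
∈-listsUpTo zero    []  _ _ = here refl
∈-listsUpTo (suc L) []  _ _ = here refl
∈-listsUpTo {k} {suc x ∷ μ} (suc L) (_ ∷ pμ) (s≤s len) (x<k ∷ μ≤k) = subst (suc x ∷ μ ∈_) (sym (listsUpTo-suc L k))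
  (there (∈-cartesianProductWith⁺ (λ x → suc x ∷_) (∈-upTo⁺ x<k) (∈-listsUpTo L pμ len μ≤k)))

length≤sum : ∀ {μ} → Positive μ → length μ ≤ sum μ
length≤sum []       = z≤n
length≤sum (p ∷ pμ) = +-mono-≤ p (length≤sum pμ)

parts≤sum : ∀ μ → All (_≤ sum μ) μ
parts≤sum []      = []
parts≤sum (x ∷ μ) = m≤m+n x (sum μ) ∷ All.map (λ h → ≤-trans h (m≤n+m (sum μ) x)) (parts≤sum μ)

∈-partitionsOf : ∀ {m μ} → IsPartitionOf m μ → μ ∈ partitionsOf m
∈-partitionsOf {m} {μ} isP = ∈-filter⁺ (isPartitionOf? m)
  (∈-listsUpTo m positive (≤-trans (length≤sum positive) (≤-reflexive sums))
    (All.map (λ h → ≤-trans h (≤-reflexive sums)) (parts≤sum μ))) isP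
  where open IsPartitionOf isP

partitionsOf-unique : ∀ m → Unique (partitionsOf m)
partitionsOf-unique m = Unique.filter⁺ (isPartitionOf? m) (listsUpTo-unique m m)

listEqᵇ-≢ : ∀ {xs ys} → xs ≢ ys → listEqᵇ xs ys ≡ false
listEqᵇ-≢ {xs} {ys} xs≢ys = ¬T⇒≡false (xs≢ys ∘ listEqᵇ⇒≡ xs ys)

-- A list without repetitions meets `x` exactly once, so one term survives. Read from right to left,
-- this spreads a value over all types, which allows grouping by coset-type.
∑-indicator : ∀ {x xs} (g : List ℕ → ℕ) → Unique xs → x ∈ xs → ∑ xs (λ y → g y * ⟦ listEqᵇ x y ⟧) ≡ g x
∑-indicator {x} {_ ∷ xs} g (x∉ ∷ _) (here refl) = trans (cong₂ _+_
  (trans (cong (λ b → g x * ⟦ b ⟧) (T⇒≡true (listEqᵇ-refl x))) (*-identityʳ (g x)))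
  (trans (∑-cong xs (λ {y} y∈ → trans (cong (λ b → g y * ⟦ b ⟧) (listEqᵇ-≢ (All.lookup x∉ y∈))) (*-zeroʳ (g y)))) (∑-zero xs)))
  (+-identityʳ (g x))
∑-indicator {x} {y ∷ xs} g (y∉ ∷ u) (there x∈) = trans
  (cong (_+ ∑ xs (λ y → g y * ⟦ listEqᵇ x y ⟧))
    (trans (cong (λ b → g y * ⟦ b ⟧) (listEqᵇ-≢ (All.lookup y∉ x∈ ∘ sym))) (*-zeroʳ (g y))))
  (∑-indicator g u x∈)

-- Pair partitions as extensions of smaller ones

pairPartitions : ℕ → List (List ℕ)
pairPartitions N = filterᵇ (isPairPartitionᵇ N) (lists N N)

∈-pairPartitions⁺ : ∀ {N p} → PairPartition N p → p ∈ pairPartitions N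
∈-pairPartitions⁺ {p = p} pp@(refl , matching) = ∈-filter⁺ (T? ∘ isPairPartitionᵇ (length p))
  (∈-lists (All-part⁺ p (Matching.bounded matching))) (pairPartition⁺ (length p) p pp)

∈-pairPartitions⁻ : ∀ {N p} → p ∈ pairPartitions N → PairPartition N p
∈-pairPartitions⁻ {N} {p} p∈ =
  pairPartition⁻ N p (proj₂ (∈-filter⁻ (T? ∘ isPairPartitionᵇ N) {xs = lists N N} p∈))

pairPartitions-unique : ∀ N → Unique (pairPartitions N)
pairPartitions-unique N = Unique.filter⁺ (T? ∘ isPairPartitionᵇ N) (lists-unique N N)

choices-unique : ∀ N → Unique (choices N)
choices-unique N = Unique.++⁺ (Unique.upTo⁺ N) ([] ∷ []) λ where
  (i , here refl) → <⇒≱ (∈-upTo⁻ i) (n≤1+n N)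

extensions : ℕ → List (List ℕ)
extensions N = map (λ (p , c) → extend N p c) (cartesianProduct (pairPartitions N) (choices N))

-- `restrict` undoes `extend`, so mapping it over the extensions returns the list of pairs; absence
-- of repetitions is pulled back from there.
extensions-unique : ∀ N → Unique (extensions N)
extensions-unique N = Unique.map⁻ {f = restrict N} (subst Unique (sym restrict-extensions)
  (Unique.cartesianProduct⁺ (pairPartitions-unique N) (choices-unique N)))
  where
  pairs : List (List ℕ × ℕ)
  pairs = cartesianProduct (pairPartitions N) (choices N)
  restrict-extensions : map (restrict N) (extensions N) ≡ pairs
  restrict-extensions = trans (sym (map-∘ pairs)) (map-id-local (All.tabulate λ {(p , c)} i →
    let p∈ , c∈ = ∈-cartesianProduct⁻ (pairPartitions N) (choices N) i in
    restrict∘extend (∈-pairPartitions⁻ p∈) (∈-choices⁻ c∈)))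

-- Repetition-free lists with the same members are permutations of each other, and sums are all that
-- is taken over them later.
pairPartitions-↭ : ∀ N → pairPartitions (2 + N) ↭ extensions N
pairPartitions-↭ N = ∼bag⇒↭ (unique∧set⇒bag (pairPartitions-unique (2 + N)) (extensions-unique N) (mk⇔ to from))
  where
  to : ∀ {p} → p ∈ pairPartitions (2 + N) → p ∈ extensions N
  to {p} p∈ = subst (_∈ extensions N) (extend∘restrict {p = p} pp) (∈-map⁺ (λ (p , c) → extend N p c)
    (∈-cartesianProduct⁺ (∈-pairPartitions⁺ {p = proj₁ (restrict N p)} (restrict-pairPartition {p = p} pp)) (∈-choices⁺ (restrict-choice {p = p} pp))))
    where
    pp : PairPartition (2 + N) p
    pp = ∈-pairPartitions⁻ p∈
  from : ∀ {p} → p ∈ extensions N → p ∈ pairPartitions (2 + N)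
  from p∈ with ∈-map⁻ (λ (p , c) → extend N p c) p∈
  ... | (p , c) , i , refl = let p∈ , c∈ = ∈-cartesianProduct⁻ (pairPartitions N) (choices N) i in
    ∈-pairPartitions⁺ (extend-pairPartition {p = p} (∈-pairPartitions⁻ p∈) (∈-choices⁻ c∈))

-- Counting extensions by coset-type

typeOf : ℕ → List ℕ → List ℕ
typeOf N p = sortDesc (map (λ v → compSize p N v / 2) (filterᵇ (isRepᵇ p N) (upTo N)))

-- `typeOf` takes the number of vertices as an argument, so `2 * m` can be exchanged for `m * 2`
-- everywhere at once. The latter form is used because `suc m * 2` reduces to `2 + m * 2`.
C-∑ : ∀ m ν → C m ν ≡ ∑ (pairPartitions (m * 2)) (λ p → ⟦ listEqᵇ (typeOf (m * 2) p) ν ⟧)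
C-∑ m ν = trans (cong count (*-comm 2 m)) (begin
  count N                                                              ≡⟨ length-filterᵇ (lists N N) _ ⟩
  ∑ (lists N N) (λ p → ⟦ isPairPartitionᵇ N p ∧ hasType N p ⟧)        ≡⟨ ∑-cong (lists N N) (λ {p} _ → ⟦⟧-∧ (isPairPartitionᵇ N p) (hasType N p)) ⟩
  ∑ (lists N N) (λ p → ⟦ isPairPartitionᵇ N p ⟧ * ⟦ hasType N p ⟧)    ≡⟨ ∑-filterᵇ (lists N N) (isPairPartitionᵇ N) _ ⟨
  ∑ (pairPartitions N) (λ p → ⟦ hasType N p ⟧)                         ∎)
  where
  open ≡-Reasoning
  N : ℕ
  N = m * 2
  hasType : ℕ → List ℕ → Bool
  hasType N p = listEqᵇ (typeOf N p) ν
  count : ℕ → ℕ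
  count N = length (filterᵇ (λ p → isPairPartitionᵇ N p ∧ hasType N p) (lists N N))

module _ (m : ℕ) (p : List ℕ) (pp : PairPartition (m * 2) p) where

  open Extension m p pp
  open Old using (conn; half; halves; reps; reps<N; half-∑-reps)
  open EvenGraph m p (proj₂ pp) using (half-positive; sum-halves; ∑-vertices-halves)

  halves-positive : Positive halves
  halves-positive = AllP.map⁺ (All.tabulate (half-positive ∘ reps<N))

  typeOf-isPartition : IsPartitionOf m (typeOf N p)
  typeOf-isPartition = record
    { positive   = All-sortDesc halves-positive
    ; decreasing = sortDesc-descending halves
    ; sums       = trans (cong sum (sym (map-id (sortDesc halves)))) (trans (∑-sortDesc halves (λ x → x)) sum-halves)
    }

  module _ {a : ℕ} (a<N : a < N) where

    grown : List ℕ
    grown = map (λ r → half r + ⟦ conn r a ⟧) reps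

    grown-positive : Positive grown
    grown-positive = AllP.map⁺ (All.tabulate (λ r∈ → ≤-trans (half-positive (reps<N r∈)) (m≤m+n _ _)))
  
    -- Both indicators of `half a` are expanded over representatives, where `conn r a` selects the
    -- component of `a`. Term by term, the selected part h counts as h + 1 in place of h and the
    -- others are unchanged.
    Raise-grown : Raise (half a) halves grown
    Raise-grown k = begin
      multiplicity grown (suc k) + ⟦ half a ≡ᵇ suc k ⟧
        ≡⟨ cong₂ _+_ (trans (multiplicity-∑ grown (suc k)) (∑-map _ reps _)) (half-∑-reps (λ x → ⟦ x ≡ᵇ suc k ⟧) a<N) ⟩
      ∑ reps (λ r → ⟦ half r + ⟦ conn r a ⟧ ≡ᵇ suc k ⟧) + ∑ reps (λ r → ⟦ conn r a ⟧ * ⟦ half r ≡ᵇ suc k ⟧)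
        ≡⟨ ∑-+ reps _ _ ⟨
      ∑ reps (λ r → ⟦ half r + ⟦ conn r a ⟧ ≡ᵇ suc k ⟧ + ⟦ conn r a ⟧ * ⟦ half r ≡ᵇ suc k ⟧)
        ≡⟨ ∑-cong reps (λ {r} _ → exchange (half r) (conn r a)) ⟩
      ∑ reps (λ r → ⟦ half r ≡ᵇ suc k ⟧ + ⟦ conn r a ⟧ * ⟦ half r ≡ᵇ k ⟧)
        ≡⟨ ∑-+ reps _ _ ⟩
      ∑ reps (λ r → ⟦ half r ≡ᵇ suc k ⟧) + ∑ reps (λ r → ⟦ conn r a ⟧ * ⟦ half r ≡ᵇ k ⟧)
        ≡⟨ cong₂ _+_ (trans (multiplicity-∑ halves (suc k)) (∑-map half reps _)) (half-∑-reps (λ x → ⟦ x ≡ᵇ k ⟧) a<N) ⟨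
      multiplicity halves (suc k) + ⟦ half a ≡ᵇ k ⟧ ∎
      where
      open ≡-Reasoning
      exchange : ∀ h c → ⟦ h + ⟦ c ⟧ ≡ᵇ suc k ⟧ + ⟦ c ⟧ * ⟦ h ≡ᵇ suc k ⟧ ≡ ⟦ h ≡ᵇ suc k ⟧ + ⟦ c ⟧ * ⟦ h ≡ᵇ k ⟧
      exchange h true rewrite +-comm h 1 | +-identityʳ ⟦ h ≡ᵇ suc k ⟧ | +-identityʳ ⟦ h ≡ᵇ k ⟧ = +-comm ⟦ h ≡ᵇ k ⟧ _
      exchange h false rewrite +-identityʳ h = refl

    typeOf-grow : typeOf (2 + N) (extend N p a) ≡ sortDesc grown
    typeOf-grow = cong sortDesc (Grow.halves-grow a<N)

  typeOf-append : typeOf (2 + N) (extend N p (suc N)) ≡ sortDesc (halves ++ 1 ∷ [])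
  typeOf-append = cong sortDesc Append.halves-append

  Raise-append : Raise 0 halves (halves ++ 1 ∷ [])
  Raise-append k = trans (+-identityʳ _) (begin
    multiplicity (halves ++ 1 ∷ []) (suc k)                                                ≡⟨ multiplicity-∑ (halves ++ 1 ∷ []) (suc k) ⟩
    ∑ (halves ++ 1 ∷ []) (λ x → ⟦ x ≡ᵇ suc k ⟧)                                            ≡⟨ ∑-++ halves (1 ∷ []) _ ⟩
    ∑ halves (λ x → ⟦ x ≡ᵇ suc k ⟧) + (⟦ 0 ≡ᵇ k ⟧ + 0)                                     ≡⟨ cong₂ _+_ (sym (multiplicity-∑ halves (suc k))) (+-identityʳ _) ⟩
    multiplicity halves (suc k) + ⟦ 0 ≡ᵇ k ⟧                                               ∎)
    where open ≡-Reasoning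

  module _ {la : List ℕ} (isP : IsPartitionOf (suc m) la) where

    open IsPartitionOf isP

    private
      hasType : ℕ → ℕ
      hasType c = ⟦ listEqᵇ (typeOf (2 + N) (extend N p c)) la ⟧

    ∑-hasType : ∑ (choices N) hasType ≡
      ∑ (upTo N) hasType + ⟦ listEqᵇ (sortDesc (halves ++ 1 ∷ [])) la ⟧
    ∑-hasType = trans (∑-++ (upTo N) (suc N ∷ []) hasType) (cong (∑ (upTo N) hasType +_)
      (trans (+-identityʳ _) (cong (λ ν → ⟦ listEqᵇ ν la ⟧) typeOf-append)))

    -- An extension at `a` has type `la` exactly when `half a` is `x₀`, and the new block does so
    -- exactly when `x₀` is 0. Counting the vertices `a` by component gives the two terms of
    -- `coef-raisedPart`.
    count-⊆Y : typeOf N p ⊆Y la → ∑ (choices N) hasType ≡ coef (typeOf N p) la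
    count-⊆Y s = begin
      ∑ (choices N) hasType
        ≡⟨ ∑-hasType ⟩
      ∑ (upTo N) hasType + ⟦ listEqᵇ (sortDesc (halves ++ 1 ∷ [])) la ⟧
        ≡⟨ cong₂ (λ x b → x + ⟦ b ⟧)
             (∑-cong (upTo N) (λ i → hasType-grow (∈-upTo⁻ i)))
             (listEqᵇ-raise {0} {x₀} {halves} Raise-append (AllP.++⁺ halves-positive (≤-refl ∷ [])) positive decreasing raise) ⟩
      ∑ (upTo N) (λ a → ⟦ half a ≡ᵇ x₀ ⟧) + ⟦ 0 ≡ᵇ x₀ ⟧
        ≡⟨ cong (_+ ⟦ 0 ≡ᵇ x₀ ⟧) (∑-vertices-halves (λ x → ⟦ x ≡ᵇ x₀ ⟧)) ⟩
      ∑ halves (λ x → x * 2 * ⟦ x ≡ᵇ x₀ ⟧) + ⟦ 0 ≡ᵇ x₀ ⟧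
        -- Under the indicator of `x` = `x₀` the factor `x` becomes the constant `x₀` and can leave
        -- the sum; for `x₀` = 0 it makes the vertex count vanish.
        ≡⟨ cong (_+ ⟦ 0 ≡ᵇ x₀ ⟧) (∑-cong halves (λ {x} _ → at-x₀ x)) ⟩
      ∑ halves (λ x → x₀ * 2 * ⟦ x ≡ᵇ x₀ ⟧) + ⟦ 0 ≡ᵇ x₀ ⟧
        ≡⟨ cong (_+ ⟦ 0 ≡ᵇ x₀ ⟧) (∑-*ˡ halves (x₀ * 2) _) ⟩
      x₀ * 2 * ∑ halves (λ x → ⟦ x ≡ᵇ x₀ ⟧) + ⟦ 0 ≡ᵇ x₀ ⟧
        ≡⟨ cong (λ n → x₀ * 2 * n + ⟦ 0 ≡ᵇ x₀ ⟧) (trans (multiplicity-sortDesc halves x₀) (multiplicity-∑ halves x₀)) ⟨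
      x₀ * 2 * multiplicity (typeOf N p) x₀ + ⟦ 0 ≡ᵇ x₀ ⟧
        ≡⟨ coef-raisedPart (typeOf N p) la ⟨
      coef (typeOf N p) la ∎
      where
      open ≡-Reasoning
      x₀ : ℕ
      x₀ = raisedPart (typeOf N p) la
      raise : Raise x₀ (typeOf N p) la
      raise = raisedPart-Raise (IsPartitionOf.positive typeOf-isPartition) positive s
        (trans sums (cong suc (sym (IsPartitionOf.sums typeOf-isPartition))))
      hasType-grow : ∀ {a} → a < N → hasType a ≡ ⟦ half a ≡ᵇ x₀ ⟧
      hasType-grow {a} a<N = cong ⟦_⟧ (trans (cong (λ ν → listEqᵇ ν la) (typeOf-grow a<N))
        (listEqᵇ-raise {half a} {x₀} {halves} (Raise-grown a<N) (grown-positive a<N) positive decreasing raise))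
      at-x₀ : ∀ x → x * 2 * ⟦ x ≡ᵇ x₀ ⟧ ≡ x₀ * 2 * ⟦ x ≡ᵇ x₀ ⟧
      at-x₀ x with x ≡ᵇ x₀ in e
      ... | true  = cong (λ x → x * 2 * 1) (≡ᵇ⇒≡ x x₀ (subst T (sym e) _))
      ... | false = trans (*-zeroʳ (x * 2)) (sym (*-zeroʳ (x₀ * 2)))

    -- Neither kind of extension shortens a row of the sorted type, so an extension of type `la`
    -- would give the containment that is denied.
    count-⊈Y : ¬ typeOf N p ⊆Y la → ∑ (choices N) hasType ≡ 0
    count-⊈Y s = trans ∑-hasType (cong₂ _+_
      (trans (∑-cong (upTo N) (λ i → none-grow (∈-upTo⁻ i))) (∑-zero (upTo N)))
      (cong ⟦_⟧ (listEqᵇ-≢ λ e → s (subst (typeOf N p ⊆Y_) e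
        (sortDesc-⊆Y {f = half} {half} (λ _ → ≤-refl) reps (1 ∷ []))))))
      where
      none-grow : ∀ {a} → a < N → hasType a ≡ 0
      none-grow {a} a<N = cong ⟦_⟧ (trans (cong (λ ν → listEqᵇ ν la) (typeOf-grow a<N)) (listEqᵇ-≢ λ e →
        s (subst (typeOf N p ⊆Y_) (trans (cong sortDesc (++-identityʳ (grown a<N))) e)
          (sortDesc-⊆Y {f = half} (λ r → m≤m+n (half r) ⟦ conn r a ⟧) reps []))))

    count-extensions : ∑ (choices N) hasType ≡ ⟦ does (typeOf N p ⊆Y? la) ⟧ * coef (typeOf N p) la
    count-extensions with typeOf N p ⊆Y? la
    ... | yes s = trans (count-⊆Y s) (sym (+-identityʳ _))
    ... | no  s = count-⊈Y s

branching : ∀ m la → IsPartitionOf (suc m) la →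
  C (suc m) la ≡ ∑ (filter (_⊆Y? la) (partitionsOf m)) (λ μ → coef μ la * C m μ)
branching m la isP = begin
  C (suc m) la
    ≡⟨ C-∑ (suc m) la ⟩
  ∑ (pairPartitions (2 + N)) hasType
    ≡⟨ ∑-↭ hasType (pairPartitions-↭ N) ⟩
  ∑ (extensions N) hasType
    ≡⟨ ∑-map _ (cartesianProduct (pairPartitions N) (choices N)) hasType ⟩
  ∑ (cartesianProduct (pairPartitions N) (choices N)) (λ (p , c) → hasType (extend N p c))
    ≡⟨ ∑-cartesianProduct (pairPartitions N) (choices N) _ ⟩
  ∑ (pairPartitions N) (λ p → ∑ (choices N) (λ c → hasType (extend N p c)))
    -- The count for `p` depends only on its coset-type. It is spread over all partitions of `m`
    -- with an indicator, so that exchanging the sums groups the pair partitions by type.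
    ≡⟨ ∑-cong (pairPartitions N) (λ {p} p∈ → trans (count-extensions m p (∈-pairPartitions⁻ p∈) isP)
         (sym (∑-indicator weight (partitionsOf-unique m) (∈-partitionsOf (typeOf-isPartition m p (∈-pairPartitions⁻ p∈)))))) ⟩
  ∑ (pairPartitions N) (λ p → ∑ (partitionsOf m) (λ μ → weight μ * ⟦ listEqᵇ (typeOf N p) μ ⟧))
    ≡⟨ ∑-swap (pairPartitions N) (partitionsOf m) (λ p μ → weight μ * ⟦ listEqᵇ (typeOf N p) μ ⟧) ⟩
  ∑ (partitionsOf m) (λ μ → ∑ (pairPartitions N) (λ p → weight μ * ⟦ listEqᵇ (typeOf N p) μ ⟧))
    ≡⟨ ∑-cong (partitionsOf m) (λ {μ} _ → trans (∑-*ˡ (pairPartitions N) (weight μ) _)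
         (trans (cong (weight μ *_) (sym (C-∑ m μ))) (*-assoc ⟦ does (μ ⊆Y? la) ⟧ (coef μ la) (C m μ)))) ⟩
  ∑ (partitionsOf m) (λ μ → ⟦ does (μ ⊆Y? la) ⟧ * (coef μ la * C m μ))
    ≡⟨ ∑-filter (partitionsOf m) (_⊆Y? la) _ ⟨
  ∑ (filter (_⊆Y? la) (partitionsOf m)) (λ μ → coef μ la * C m μ)
    ∎
  where
  open ≡-Reasoning
  N : ℕ
  N = m * 2
  hasType : List ℕ → ℕ
  hasType p = ⟦ listEqᵇ (typeOf (2 + N) p) la ⟧
  weight : List ℕ → ℕ
  weight μ = ⟦ does (μ ⊆Y? la) ⟧ * coef μ la

theorem5p1 : (n : ℕ) → 2 ≤ n → (λ′ : List ℕ) → IsPartitionOf n λ′ →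
    C n λ′ ≡ sum (map (λ μ → coef μ λ′ * C (n ∸ 1) μ) (filter (_⊆Y? λ′) (partitionsOf (n ∸ 1))))
theorem5p1 (suc m) _ λ′ isP = branching m λ′ isP
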